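{- Let $\mathcal{S}_n$ be the number of triangles having exactly one side in common with the perimeter of $P_n$ in a uniformly random triangulation $\mathcal{T}_n$ of a convex $n$-gon $P_n$, and let $g_n(z)=\mathbb{E}(z^{\mathcal{S}_n})$. Then: (I) For all $n\ge 4$, $$g_n(z)=\frac{1}{C_{n-2}}\sum_{j=0}^{n-2}C_j\left[2\binom{j+2}{n-2-j}-\binom{j+1}{n-2-j}\right]z^{2j+4-n}(1-z^2)^{n-2-j}.$$ (II) For all $n\ge 4$, $\mathbb{E}(\mathcal{S}_n)=\dfrac{n(n-4)}{2n-5}$. (III) For all $n\ge 5$, $\mathrm{Var}(\mathcal{S}_n)=\dfrac{2n(n-1)(n-4)(n-5)}{(2n-5)^2(2n-7)}$.
   Context: $P_n$ has vertices $v_{n,1},\dots,v_{n,n}$ in clockwise order. A triangulation of $P_n$ is a set of $n-3$ noncrossing diagonals partitioning $P_n$ into $n-2$ triangles; there are $C_{n-2}$ of them, where $C_k=\frac{1}{k+1}\binom{2k}{k}$, and $\mathcal{T}_n$ is chosen uniformly among them. Equivalently $\mathcal{S}_n=\sum_{\Delta\in\mathcal{T}_n}f_n(\Delta)$, where for $1\le l<j<r\le n$ the weight $f_{n,l,j,r}$ of the triangle with vertices $v_{n,l},v_{n,j},v_{n,r}$ is $1$ in each of the following cases and $0$ otherwise: $l>1$, $j=l+1$, $j+1<r\le n$; $l>1$, $j>l+1$, $r=j+1\le n$; $l=1$, $r=n$, $2<j<n-1$; $l=1$, $j=2$, $3<r<n$; $l=1$, $j>2$, $r=j+1<n$. Here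 $z$ is a complex variable, $\binom{a}{b}=0$ when $b>a\geq 0$, and terms with zero coefficient are taken to be $0$ (the terms with a negative exponent of $z$ all have zero coefficient). -}

module Defs where

open import Algebra.Bundles using (CommutativeRing)
open import Algebra.Morphism.Structures using (module RingMorphisms)
import Algebra.Morphism.Construct.Identity as Identity
import Algebra.Properties.Semiring.Exp as Exp
open import Data.Integer.Base as ℤ using (ℤ; +_)
open import Data.List.Base
  using (List; []; _∷_; _++_; map; foldr; filter; length; upTo; applyUpTo; cartesianProduct)
import Data.List.Membership.DecPropositional as DecMembership
open import Data.List.Membership.Propositional using (_∈_)
open import Data.List.Relation.Unary.All using (All; all?)
open import Data.List.Relation.Unary.AllPairs using (AllPairs; allPairs?)
open import Data.Nat.Base using (ℕ; zero; suc; _+_; _*_; _∸_; _<_; _/_)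
open import Data.Nat.Combinatorics using () renaming (_C_ to binom)
open import Data.Nat.Properties using (_≟_; _<?_)
open import Data.Product.Base using (_×_; _,_)
open import Data.Product.Properties using (≡-dec)
open import Data.Rational.Base as ℚ using (ℚ; 0ℚ)
open import Data.Rational.Properties using (+-*-commutativeRing)
open import Data.Sum.Base using (_⊎_)
open import Function.Base using (id)
open import Level using (Level; 0ℓ; _⊔_) renaming (suc to lsuc)
open import Relation.Binary.PropositionalEquality.Core using (_≡_; refl)
open import Relation.Nullary.Decidable using (Dec; _×-dec_; _⊎-dec_; ¬?)
open import Relation.Nullary.Negation using (¬_)
open import Relation.Unary using (Decidable)

-- The vertices of Pₙ are the numbers 1, …, n in cyclic order.  A segment is a
-- pair (i , j) of vertices with i < j.

Segment : Set
Segment = ℕ × ℕ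

vertices : ℕ → List ℕ
vertices n = applyUpTo suc n

Increasing : Segment → Set
Increasing (i , j) = i < j

increasing? : Decidable Increasing
increasing? (i , j) = i <? j

Side : ℕ → Segment → Set
Side n (i , j) = j ≡ suc i ⊎ (i ≡ 1 × j ≡ n)

side? : ∀ n → Decidable (Side n)
side? n (i , j) = (j ≟ suc i) ⊎-dec ((i ≟ 1) ×-dec (j ≟ n))

segments : ℕ → List Segment
segments n = filter increasing? (cartesianProduct (vertices n) (vertices n))

diagonals : ℕ → List Segment
diagonals n = filter (λ s → ¬? (side? n s)) (segments n)

Crossing : Segment → Segment → Set
Crossing (i , j) (k , l) = (i < k × k < j × j < l) ⊎ (k < i × i < l × l < j)

crossing? : ∀ s t → Dec (Crossing s t)
crossing? (i , j) (k , l) =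
  ((i <? k) ×-dec ((k <? j) ×-dec (j <? l))) ⊎-dec
  ((k <? i) ×-dec ((i <? l) ×-dec (l <? j)))

NonCrossing : List Segment → Set
NonCrossing = AllPairs (λ s t → ¬ Crossing s t)

nonCrossing? : Decidable NonCrossing
nonCrossing? = allPairs? (λ s t → ¬? (crossing? s t))

Triangle : Set
Triangle = ℕ × ℕ × ℕ

sidesOf : Triangle → List Segment
sidesOf (l , j , r) = (l , j) ∷ (j , r) ∷ (l , r) ∷ []

Edge : ℕ → List Segment → Segment → Set
Edge n T s = Side n s ⊎ s ∈ T

edge? : ∀ n T → Decidable (Edge n T)
edge? n T s = side? n s ⊎-dec (s ∈? T)
  where open DecMembership (≡-dec _≟_ _≟_) using (_∈?_)

-- If T is noncrossing, no diagonal of T meets the interior of a triangle all of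
-- whose sides are edges, as the vertices are in convex position.  So these are
-- exactly the triangular regions into which T divides Pₙ.

IsTriangle : ℕ → List Segment → Triangle → Set
IsTriangle n T (l , j , r) = l < j × j < r × All (Edge n T) (sidesOf (l , j , r))

isTriangle? : ∀ n T → Decidable (IsTriangle n T)
isTriangle? n T (l , j , r) =
  (l <? j) ×-dec ((j <? r) ×-dec all? (edge? n T) (sidesOf (l , j , r)))

triangles : ℕ → List Segment → List Triangle
triangles n T =
  filter (isTriangle? n T)
    (cartesianProduct (vertices n) (cartesianProduct (vertices n) (vertices n)))

IsTriangulation : ℕ → List Segment → Set
IsTriangulation n T =
  length T ≡ n ∸ 3 × NonCrossing T × length (triangles n T) ≡ n ∸ 2

isTriangulation? : ∀ n → Decidable (IsTriangulation n)
isTriangulation? n T =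
  (length T ≟ n ∸ 3) ×-dec (nonCrossing? T ×-dec (length (triangles n T) ≟ n ∸ 2))

-- All subsets of a duplicate-free list, each exactly once.

subsets : ∀ {a} {A : Set a} → List A → List (List A)
subsets []       = [] ∷ []
subsets (x ∷ xs) = map (x ∷_) (subsets xs) ++ subsets xs

triangulations : ℕ → List (List Segment)
triangulations n = filter (isTriangulation? n) (subsets (diagonals n))

perimeterSides : ℕ → Triangle → ℕ
perimeterSides n t = length (filter (side? n) (sidesOf t))

S : ℕ → List Segment → ℕ
S n T = length (filter (λ t → perimeterSides n t ≟ 1) (triangles n T))

-- Division with the convention p / 0 = 0.  No denominator below vanishes when
-- n ≥ 4: Pₙ has a triangulation, catalan is positive and 2n - 7 > 0.

infixl 7 _/₀_

_/₀_ : ℤ → ℕ → ℚ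
p /₀ zero  = 0ℚ
p /₀ suc q = p ℚ./ suc q

fromℤ : ℤ → ℚ
fromℤ p = p ℚ./ 1

-- The division is exact.

catalan : ℕ → ℕ
catalan k = binom (2 * k) k / suc k

coefficient : ℕ → ℕ → ℤ
coefficient n j =
  + catalan j ℤ.*
    (+ 2 ℤ.* + binom (j + 2) (n ∸ 2 ∸ j) ℤ.- + binom (j + 1) (n ∸ 2 ∸ j))

-- The library has no complex numbers; the variable z of the probability
-- generating function ranges over an arbitrary commutative ℚ-algebra instead,
-- of which ℂ and ℚ[z] are instances.

record ℚ-Algebra (c ℓ : Level) : Set (lsuc (c ⊔ ℓ)) where
  field
    commutativeRing : CommutativeRing c ℓ
  open CommutativeRing commutativeRing public
    using (Carrier; _≈_; 0#; 1#; rawRing; semiring)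
    renaming (_+_ to _+ᴬ_; _*_ to _*ᴬ_; _-_ to _-ᴬ_)
  field
    ι : ℚ → Carrier
    ι-isRingHomomorphism :
      RingMorphisms.IsRingHomomorphism ℚ.+-*-rawRing rawRing ι
  open Exp semiring public using () renaming (_^_ to _^ᴬ_)

  sumᴬ : List Carrier → Carrier
  sumᴬ = foldr _+ᴬ_ 0#

ℚ-algebra : ℚ-Algebra 0ℓ 0ℓ
ℚ-algebra = record
  { commutativeRing      = +-*-commutativeRing
  ; ι                    = id
  ; ι-isRingHomomorphism = Identity.isRingHomomorphism ℚ.+-*-rawRing refl
  }

module _ {c ℓ : Level} (A : ℚ-Algebra c ℓ) where
  open ℚ-Algebra A

  -- Expectation of X for a uniformly random triangulation of Pₙ.

  𝔼 : ℕ → (List Segment → Carrier) → Carrier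
  𝔼 n X = ι ((+ 1) /₀ length (triangulations n)) *ᴬ sumᴬ (map X (triangulations n))

  g : ℕ → Carrier → Carrier
  g n z = 𝔼 n (λ T → z ^ᴬ S n T)

  -- When 2j + 4 < n, both binomials vanish, so the truncation of the exponent
  -- 2j + 4 - n only affects terms that are zero.

  gFormula : ℕ → Carrier → Carrier
  gFormula n z =
    ι ((+ 1) /₀ catalan (n ∸ 2)) *ᴬ
    sumᴬ (map (λ j → ι (fromℤ (coefficient n j))
                       *ᴬ z ^ᴬ (2 * j + 4 ∸ n)
                       *ᴬ (1# -ᴬ z ^ᴬ 2) ^ᴬ (n ∸ 2 ∸ j))
              (upTo (n ∸ 1)))

Sℚ : ℕ → List Segment → ℚ
Sℚ n T = fromℤ (+ S n T)

mean : ℕ → ℚ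
mean n = 𝔼 ℚ-algebra n (Sℚ n)

variance : ℕ → ℚ
variance n = 𝔼 ℚ-algebra n (λ T → (Sℚ n T ℚ.- mean n) ℚ.* (Sℚ n T ℚ.- mean n))

module Submission where

open import Defs

-- Triangulations of Pₙ correspond to binary trees with n - 1 leaves: the edge
-- (1 , n) is the root, the sides (i , i + 1) are the leaves, and a triangle with
-- longest side (l , r) joins the subtrees over its two other sides.  A non-root
-- triangle has exactly one side on the perimeter iff exactly one child is a leaf.
-- Weighting a leaf by z makes the weight z^(number of such triangles)
-- multiplicative in the two subtrees, except for the tree with two leaves, so with
-- w = 1 - z² the weighted generating function H satisfies H = z x + w x² + H², that
-- is, H = u C(u) with u = x (z + w x) and C the Catalan generating function.
-- Treating the root separately, C_{n-2} gₙ is the coefficient of x^(n-1) in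
-- (z + 2 w x) H, which expands to (I).  For (II) and (III), put z = e^t in (I)
-- and expand modulo t³: as t divides w, only the last three summands matter.

-- `IsTriangulation` only counts diagonals and triangles, so the tree behind a triangulation has to
-- be recovered by counting: the n - 2 triangles have distinct longest sides, there are only n - 2
-- candidates for these, and so every candidate edge has a triangle below it.
--
-- The quadratic equation for H is never solved. Series are coefficient sequences, and it is enough
-- that replacing x by x (z + w x) respects products: this turns the Catalan convolution into the
-- convolution satisfied by H.
--
-- Subtraction is kept out of that argument. The element w is only required to satisfy z² + w = 1,
-- and the bracket in (I) is rewritten as a sum of binomials. The resulting identity therefore holds
-- in every commutative semiring. Over the given algebra it yields (I); over triples of a value and
-- two derivatives, multiplied by the Leibniz rule, it yields the count of trees and both moments
-- without any analysis.

module Dissections where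

  import Data.List.Membership.DecPropositional as DecMembership
  import Data.List.Relation.Unary.Unique.Propositional.Properties as Unique
  open import Data.Empty using (⊥-elim)
  open import Data.List.Base using (List; []; _∷_; _++_; map; filter; length; cartesianProductWith)
  open import Data.List.Membership.Propositional using (_∈_; _∉_)
  open import Data.List.Membership.Propositional.Properties
  open import Data.List.Membership.Propositional.Properties.WithK using (unique∧set⇒bag)
  open import Data.List.Properties using (∷-injectiveʳ; length-map; length-++; filter-accept; filter-reject; filter-++)
  open import Data.List.Relation.Binary.BagAndSetEquality using (∼bag⇒↭)
  open import Data.List.Relation.Binary.Permutation.Propositional using (_↭_)
  open import Data.List.Relation.Binary.Permutation.Propositional.Properties using (↭-length; filter-↭)
  open import Data.List.Relation.Binary.Subset.Propositional using (_⊆_)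
  open import Data.List.Relation.Unary.All as All using (All; []; _∷_)
  open import Data.List.Relation.Unary.AllPairs using ([]; _∷_)
  open import Data.List.Relation.Unary.Any using (here; there)
  open import Data.List.Relation.Unary.Unique.Propositional using (Unique)
  open import Data.Nat.Base
  open import Data.Nat.Properties
  open import Data.Product.Base using (_×_; _,_; proj₁; proj₂; ∃; ∃₂)
  open import Data.Product.Properties using (≡-dec; ,-injectiveˡ)
  open import Data.Sum.Base using (_⊎_; inj₁; inj₂)
  open import Function.Base using (_∘_)
  open import Function.Bundles using (mk⇔)
  open import Level using (Level)
  open import Relation.Binary.Definitions using (DecidableEquality; tri<; tri≈; tri>)
  open import Relation.Binary.PropositionalEquality
  open import Relation.Nullary
  open import Relation.Unary using (Pred; Decidable)

  private variable
    a p : Level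
    A : Set a

  -- Duplicate-free lists and subsets.

  unique∧⊆∧⊇⇒↭ : {xs ys : List A} → Unique xs → Unique ys → xs ⊆ ys → ys ⊆ xs → xs ↭ ys
  unique∧⊆∧⊇⇒↭ u v f g = ∼bag⇒↭ (unique∧set⇒bag u v (mk⇔ f g))

  unique∧⊆⇒length≤ : {xs ys : List A} → Unique xs → xs ⊆ ys → length xs ≤ length ys
  unique∧⊆⇒length≤ [] _ = z≤n
  unique∧⊆⇒length≤ {xs = x ∷ xs} (x≢xs ∷ u) xs⊆ys with ∈-∃++ (xs⊆ys (here refl))
  ... | us , vs , refl = begin
    suc (length xs)               ≤⟨ s≤s (unique∧⊆⇒length≤ u xs⊆us++vs) ⟩
    suc (length (us ++ vs))       ≡⟨ cong suc (length-++ us) ⟩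
    suc (length us + length vs)   ≡⟨ +-suc (length us) (length vs) ⟨
    length us + suc (length vs)   ≡⟨ length-++ us ⟨
    length (us ++ x ∷ vs)         ∎
    where
    open ≤-Reasoning
    xs⊆us++vs : xs ⊆ us ++ vs
    xs⊆us++vs y∈xs with ∈-++⁻ us (xs⊆ys (there y∈xs))
    ... | inj₁ y∈us         = ∈-++⁺ˡ y∈us
    ... | inj₂ (here refl)  = ⊥-elim (All.lookup x≢xs y∈xs refl)
    ... | inj₂ (there y∈vs) = ∈-++⁺ʳ us y∈vs

  module _ (_≟_ : DecidableEquality A) where
    open DecMembership _≟_ using (_∈?_)

    -- Pigeonhole: a `y` of `ys` missing from `xs` would make `y ∷ xs` a duplicate-free list inside
    -- `ys` that is longer than `ys`. This converts the counts in `IsTriangulation` into coverings.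
    unique∧⊆∧length≥⇒⊇ : {xs ys : List A} → Unique xs → xs ⊆ ys → length ys ≤ length xs → ys ⊆ xs
    unique∧⊆∧length≥⇒⊇ {xs} {ys} u xs⊆ys ys≤xs {y} y∈ys with y ∈? xs
    ... | yes y∈xs = y∈xs
    ... | no  y∉xs = ⊥-elim (<-irrefl refl (≤-trans (unique∧⊆⇒length≤ (y≢xs ∷ u) y∷xs⊆ys) ys≤xs))
      where
      y≢xs : All (y ≢_) xs
      y≢xs = All.tabulate λ z∈xs y≡z → y∉xs (subst (_∈ xs) (sym y≡z) z∈xs)
      y∷xs⊆ys : y ∷ xs ⊆ ys
      y∷xs⊆ys (here refl)  = y∈ys
      y∷xs⊆ys (there z∈xs) = xs⊆ys z∈xs

  filter∈subsets : {P : Pred A p} (P? : Decidable P) (xs : List A) → filter P? xs ∈ subsets xs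
  filter∈subsets P? []       = here refl
  filter∈subsets P? (x ∷ xs) with P? x
  ... | yes _ = ∈-++⁺ˡ (∈-map⁺ (x ∷_) (filter∈subsets P? xs))
  ... | no  _ = ∈-++⁺ʳ (map (x ∷_) (subsets xs)) (filter∈subsets P? xs)

  ∈subsets⇒⊆ : ∀ {xs ys : List A} → ys ∈ subsets xs → ys ⊆ xs
  ∈subsets⇒⊆ {xs = []}     (here refl) ()
  ∈subsets⇒⊆ {xs = x ∷ xs} ys∈ y∈ys with ∈-++⁻ (map (x ∷_) (subsets xs)) ys∈
  ... | inj₂ ys∈′ = there (∈subsets⇒⊆ ys∈′ y∈ys)
  ... | inj₁ ys∈′ with ∈-map⁻ (x ∷_) ys∈′
  ...   | zs , zs∈ , refl with y∈ys
  ...     | here refl  = here refl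
  ...     | there y∈zs = there (∈subsets⇒⊆ zs∈ y∈zs)

  -- The lists in `subsets xs` keep the order of `xs`, so membership alone determines them. This
  -- gives a true equality of a triangulation with `diagonalsOf n t` instead of a permutation.
  subset≡filter : {P : Pred A p} (P? : Decidable P) {xs ys : List A} → Unique xs → ys ∈ subsets xs →
    (∀ {x} → x ∈ ys → P x) → (∀ {x} → x ∈ xs → P x → x ∈ ys) → ys ≡ filter P? xs
  subset≡filter P? {[]} _ (here refl) _ _ = refl
  subset≡filter P? {x ∷ xs} {ys} (x≢xs ∷ u) ys∈ f g with ∈-++⁻ (map (x ∷_) (subsets xs)) ys∈ | P? x
  ... | inj₂ ys∈′ | yes px = ⊥-elim (All.lookup x≢xs (∈subsets⇒⊆ ys∈′ (g (here refl) px)) refl)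
  ... | inj₂ ys∈′ | no ¬px = subset≡filter P? u ys∈′ f (g ∘ there)
  ... | inj₁ ys∈′ | px? with ∈-map⁻ (x ∷_) ys∈′
  ...   | zs , zs∈ , refl with px?
  ...     | no ¬px = ⊥-elim (¬px (f (here refl)))
  ...     | yes px = cong (x ∷_) (subset≡filter P? u zs∈ (f ∘ there) g′)
    where
    g′ : ∀ {y} → y ∈ xs → _ → y ∈ zs
    g′ y∈xs py with g (there y∈xs) py
    ... | here refl  = ⊥-elim (All.lookup x≢xs y∈xs refl)
    ... | there y∈zs = y∈zs

  subsets-unique : {xs : List A} → Unique xs → Unique (subsets xs)
  subsets-unique [] = [] ∷ []
  subsets-unique {xs = x ∷ xs} (x≢xs ∷ u) =
    Unique.++⁺ (Unique.map⁺ ∷-injectiveʳ (subsets-unique u)) (subsets-unique u) disjoint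
    where
    disjoint : ∀ {ys} → ¬ (ys ∈ map (x ∷_) (subsets xs) × ys ∈ subsets xs)
    disjoint (ys∈₁ , ys∈₂) with ∈-map⁻ (x ∷_) ys∈₁
    ... | _ , _ , refl = All.lookup x≢xs (∈subsets⇒⊆ ys∈₂ (here refl)) refl

  -- Injectivity is asked only on the list itself, because `base` forgets the apex and is injective
  -- only within a single dissection.
  unique-map : ∀ {b} {B : Set b} {f : A → B} {xs : List A} →
    (∀ {x y} → x ∈ xs → y ∈ xs → f x ≡ f y → x ≡ y) → Unique xs → Unique (map f xs)
  unique-map inj [] = []
  unique-map {f = f} {xs = x ∷ xs} inj (x≢xs ∷ u) =
    All.tabulate fx≢ ∷ unique-map (λ p q → inj (there p) (there q)) u
    where
    fx≢ : ∀ {z} → z ∈ map f xs → f x ≢ z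
    fx≢ z∈ eq with ∈-map⁻ f z∈
    ... | y , y∈xs , refl = All.lookup x≢xs y∈xs (inj (here refl) (there y∈xs) eq)

  -- Binary trees as dissections of polygons.

  _≟ˢ_ : DecidableEquality Segment
  _≟ˢ_ = ≡-dec _≟_ _≟_

  open DecMembership _≟ˢ_ using (_∈?_)

  data Tree : Set where
    leaf : Tree
    node : Tree → Tree → Tree

  size : Tree → ℕ
  size leaf       = 0
  size (node a b) = suc (size a + size b)

  -- A tree dissects the polygon on the vertices l, …, end l t: its leaves are the
  -- sides (i , i + 1) and its internal nodes are the triangles.

  end : ℕ → Tree → ℕ
  end l leaf       = suc l
  end l (node a b) = end (end l a) b

  nodes : ℕ → Tree → List Triangle
  nodes l leaf       = []
  nodes l (node a b) = (l , end l a , end (end l a) b) ∷ nodes l a ++ nodes (end l a) b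

  base : Triangle → Segment
  base (l , _ , r) = l , r

  -- The base of the root is included. For a dissection of the whole polygon this is the side (1 ,
  -- n), so there is one chord more than there are diagonals.
  chords : ℕ → Tree → List Segment
  chords l t = map base (nodes l t)

  -- The counterpart of `Edge` for trees. The consecutive pairs account for the leaves; the side (1
  -- , n) is already a chord.
  Link : ℕ → Tree → Segment → Set
  Link l t (p , q) = q ≡ suc p ⊎ (p , q) ∈ chords l t

  end≡ : ∀ l t → end l t ≡ l + suc (size t)
  end≡ l leaf       = sym (+-comm l 1)
  end≡ l (node a b) = begin
    end (end l a) b                      ≡⟨ end≡ (end l a) b ⟩
    end l a + suc (size b)               ≡⟨ cong (_+ suc (size b)) (end≡ l a) ⟩
    l + suc (size a) + suc (size b)      ≡⟨ +-assoc l _ _ ⟩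
    l + suc (size a + suc (size b))      ≡⟨ cong (λ k → l + suc k) (+-suc (size a) (size b)) ⟩
    l + suc (suc (size a + size b))      ∎
    where open ≡-Reasoning

  length-nodes : ∀ l t → length (nodes l t) ≡ size t
  length-nodes l leaf       = refl
  length-nodes l (node a b) = cong suc (begin
    length (nodes l a ++ nodes (end l a) b)             ≡⟨ length-++ (nodes l a) ⟩
    length (nodes l a) + length (nodes (end l a) b)     ≡⟨ cong₂ _+_ (length-nodes l a) (length-nodes (end l a) b) ⟩
    size a + size b                                     ∎)
    where open ≡-Reasoning

  l<end : ∀ l t → l < end l t
  l<end l leaf       = ≤-refl
  l<end l (node a b) = <-trans (l<end l a) (l<end (end l a) b)

  data NodeView (l : ℕ) (a b : Tree) : Triangle → Set where
    root  : NodeView l a b (l , end l a , end (end l a) b)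
    left  : ∀ {x} → x ∈ nodes l a → NodeView l a b x
    right : ∀ {x} → x ∈ nodes (end l a) b → NodeView l a b x

  nodeView : ∀ l a b {x} → x ∈ nodes l (node a b) → NodeView l a b x
  nodeView l a b (here refl) = root
  nodeView l a b (there x∈) with ∈-++⁻ (nodes l a) x∈
  ... | inj₁ x∈a = left x∈a
  ... | inj₂ x∈b = right x∈b

  ∈-left : ∀ l a b {x} → x ∈ nodes l a → x ∈ nodes l (node a b)
  ∈-left l a b x∈ = there (∈-++⁺ˡ x∈)

  ∈-right : ∀ l a b {x} → x ∈ nodes (end l a) b → x ∈ nodes l (node a b)
  ∈-right l a b x∈ = there (∈-++⁺ʳ (nodes l a) x∈)

  node-bounds : ∀ l t {p m q} → (p , m , q) ∈ nodes l t → l ≤ p × p < m × m < q × q ≤ end l t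
  node-bounds l (node a b) x∈ with nodeView l a b x∈
  ... | root = ≤-refl , l<end l a , l<end (end l a) b , ≤-refl
  ... | left y with node-bounds l a y
  ...   | l≤p , p<m , m<q , q≤ = l≤p , p<m , m<q , ≤-trans q≤ (<⇒≤ (l<end (end l a) b))
  node-bounds l (node a b) x∈ | right y with node-bounds (end l a) b y
  ...   | l≤p , p<m , m<q , q≤ = ≤-trans (<⇒≤ (l<end l a)) l≤p , p<m , m<q , q≤

  ∈chords⁻ : ∀ {l t p q} → (p , q) ∈ chords l t → ∃ λ m → (p , m , q) ∈ nodes l t
  ∈chords⁻ s∈ with ∈-map⁻ base s∈
  ... | (_ , m , _) , x∈ , refl = m , x∈

  chord-bounds : ∀ l t {p q} → (p , q) ∈ chords l t → l ≤ p × suc p < q × q ≤ end l t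
  chord-bounds l t s∈ with ∈chords⁻ {l} {t} s∈
  ... | m , x∈ with node-bounds l t x∈
  ...   | l≤p , p<m , m<q , q≤ = l≤p , ≤-<-trans p<m m<q , q≤

  root-link : ∀ l t → Link l t (l , end l t)
  root-link l leaf       = inj₁ refl
  root-link l (node a b) = inj₂ (here refl)

  link-left : ∀ l a b {s} → Link l a s → Link l (node a b) s
  link-left l a b (inj₁ e)  = inj₁ e
  link-left l a b (inj₂ s∈) with ∈chords⁻ {l} {a} s∈
  ... | m , x∈ = inj₂ (∈-map⁺ base (∈-left l a b x∈))

  link-right : ∀ l a b {s} → Link (end l a) b s → Link l (node a b) s
  link-right l a b (inj₁ e)  = inj₁ e
  link-right l a b (inj₂ s∈) with ∈chords⁻ {end l a} {b} s∈
  ... | m , x∈ = inj₂ (∈-map⁺ base (∈-right l a b x∈))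

  node-links : ∀ l t {p m q} → (p , m , q) ∈ nodes l t → Link l t (p , m) × Link l t (m , q)
  node-links l (node a b) x∈ with nodeView l a b x∈
  ... | root = link-left l a b (root-link l a) , link-right l a b (root-link (end l a) b)
  ... | left y with node-links l a y
  ...   | u , v = link-left l a b u , link-left l a b v
  node-links l (node a b) x∈ | right y with node-links (end l a) b y
  ...   | u , v = link-right l a b u , link-right l a b v

  crossing-sym : ∀ {s t} → Crossing s t → Crossing t s
  crossing-sym (inj₁ c) = inj₂ c
  crossing-sym (inj₂ c) = inj₁ c

  nested-noncrossing : ∀ {l r p q} → l ≤ p → q ≤ r → ¬ Crossing (l , r) (p , q)
  nested-noncrossing l≤p q≤r (inj₁ (_ , _ , r<q)) = <⇒≱ r<q q≤r
  nested-noncrossing l≤p q≤r (inj₂ (p<l , _ , _)) = <⇒≱ p<l l≤p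

  separated-noncrossing : ∀ {p q p′ q′} → p < q → q ≤ p′ → ¬ Crossing (p , q) (p′ , q′)
  separated-noncrossing p<q q≤p′ (inj₁ (_ , p′<q , _)) = <⇒≱ p′<q q≤p′
  separated-noncrossing p<q q≤p′ (inj₂ (p′<p , _)) = <⇒≱ (<-trans p′<p p<q) q≤p′

  -- The base of the root encloses all others, and the vertex `end l a` separates the bases of the
  -- two subtrees.
  nodes-noncrossing : ∀ l t {x y} → x ∈ nodes l t → y ∈ nodes l t → ¬ Crossing (base x) (base y)
  nodes-noncrossing l (node a b) {x} {y} x∈ y∈
    with nodeView l a b x∈ | nodeView l a b y∈
  ... | root | _ = nested-noncrossing (proj₁ (node-bounds l (node a b) y∈))
                     (proj₂ (proj₂ (proj₂ (node-bounds l (node a b) y∈))))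
  ... | left _ | root = nested-noncrossing (proj₁ (node-bounds l (node a b) x∈))
                     (proj₂ (proj₂ (proj₂ (node-bounds l (node a b) x∈)))) ∘ crossing-sym
  ... | right _ | root = nested-noncrossing (proj₁ (node-bounds l (node a b) x∈))
                     (proj₂ (proj₂ (proj₂ (node-bounds l (node a b) x∈)))) ∘ crossing-sym
  ... | left u | left v = nodes-noncrossing l a u v
  ... | right u | right v = nodes-noncrossing (end l a) b u v
  ... | left u | right v with node-bounds l a u | node-bounds (end l a) b v
  ...   | _ , p<m , m<q , q≤ | ≤p′ , _ = separated-noncrossing (<-trans p<m m<q) (≤-trans q≤ ≤p′)
  nodes-noncrossing l (node a b) {x} {y} x∈ y∈ | right v | left u with node-bounds l a u | node-bounds (end l a) b v
  ...   | _ , p<m , m<q , q≤ | ≤p′ , _ = separated-noncrossing (<-trans p<m m<q) (≤-trans q≤ ≤p′) ∘ crossing-sym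

  left-right-disjoint : ∀ l a b {p m q m′ q′} → (p , m , q) ∈ nodes l a → (p , m′ , q′) ∉ nodes (end l a) b
  left-right-disjoint l a b u v with node-bounds l a u | node-bounds (end l a) b v
  ... | _ , p<m , m<q , q≤ | ≤p , _ = <⇒≱ (<-≤-trans (<-trans p<m m<q) q≤) ≤p

  root∉left : ∀ l a b {p m} → (p , m , end (end l a) b) ∉ nodes l a
  root∉left l a b x∈ with node-bounds l a x∈
  ... | _ , _ , _ , q≤ = <⇒≱ (l<end (end l a) b) q≤

  root∉right : ∀ l a b {m q} → (l , m , q) ∉ nodes (end l a) b
  root∉right l a b x∈ with node-bounds (end l a) b x∈
  ... | ≤p , _ = <⇒≱ (l<end l a) ≤p

  -- A left base starts before `end l a` and a right base does not. A left base ends before the root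
  -- does, and a right base starts after it. So equal bases come from the same part of the tree.
  base-injective : ∀ l t {p m m′ q} → (p , m , q) ∈ nodes l t → (p , m′ , q) ∈ nodes l t → m ≡ m′
  base-injective l (node a b) x∈ y∈ with nodeView l a b x∈ | nodeView l a b y∈
  ... | root    | root    = refl
  ... | root    | left v  = ⊥-elim (root∉left l a b v)
  ... | root    | right v = ⊥-elim (root∉right l a b v)
  ... | left u  | root    = ⊥-elim (root∉left l a b u)
  ... | right u | root    = ⊥-elim (root∉right l a b u)
  ... | left u  | left v  = base-injective l a u v
  ... | left u  | right v = ⊥-elim (left-right-disjoint l a b u v)
  ... | right u | left v  = ⊥-elim (left-right-disjoint l a b v u)
  ... | right u | right v = base-injective (end l a) b u v

  nodes-unique : ∀ l t → Unique (nodes l t)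
  nodes-unique l leaf       = []
  nodes-unique l (node a b) =
    All.tabulate (λ x∈ eq → root≢ x∈ (sym eq)) ∷
    Unique.++⁺ (nodes-unique l a) (nodes-unique (end l a) b)
      (λ (u , v) → left-right-disjoint l a b u v)
    where
    root≢ : ∀ {x} → x ∈ nodes l a ++ nodes (end l a) b → x ≢ (l , end l a , end (end l a) b)
    root≢ x∈ refl with ∈-++⁻ (nodes l a) x∈
    ... | inj₁ u = root∉left l a b u
    ... | inj₂ v = root∉right l a b v

  chords-unique : ∀ l t → Unique (chords l t)
  chords-unique l t = unique-map inj (nodes-unique l t)
    where
    inj : ∀ {x y} → x ∈ nodes l t → y ∈ nodes l t → base x ≡ base y → x ≡ y
    inj {p , m , q} {_ , m′ , _} u v refl = cong (λ k → p , k , q) (base-injective l t u v)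

  -- Equal ends give both root triangles the same base, hence by `base-injective` the same apex. A
  -- node of one subtree then cannot be the other root or lie beyond the apex, so the inclusion
  -- restricts to the subtrees.
  nodes-injective : ∀ l t t′ → end l t ≡ end l t′ → nodes l t ⊆ nodes l t′ → t ≡ t′
  nodes-injective l leaf leaf _ _ = refl
  nodes-injective l leaf (node a b) e _ =
    ⊥-elim (<-irrefl e (≤-<-trans (l<end l a) (l<end (end l a) b)))
  nodes-injective l (node a b) leaf e f with () ← f (here refl)
  nodes-injective l (node a b) (node a′ b′) e f = cong₂ node a≡a′ b≡b′
    where
    e′ : end l a ≡ end l a′
    e′ = base-injective l (node a′ b′) (f (here refl))
           (subst (λ r → (l , end l a′ , r) ∈ nodes l (node a′ b′)) (sym e) (here refl))
    fa : nodes l a ⊆ nodes l a′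
    fa {x} x∈ with nodeView l a′ b′ (f (∈-left l a b x∈))
    ... | left v  = v
    ... | root    = ⊥-elim (root∉left l a b (subst (λ r → (l , end l a′ , r) ∈ nodes l a) (sym e) x∈))
    ... | right v with node-bounds l a x∈ | node-bounds (end l a′) b′ v
    ...   | _ , p<m , m<q , q≤ | ≤p , _ =
            ⊥-elim (<⇒≱ (<-≤-trans (<-trans p<m m<q) q≤) (≤-trans (≤-reflexive e′) ≤p))
    a≡a′ : a ≡ a′
    a≡a′ = nodes-injective l a a′ e′ fa
    fb : nodes (end l a) b ⊆ nodes (end l a) b′
    fb {x} x∈ with nodeView l a′ b′ (f (∈-right l a b x∈))
    ... | right v = subst (λ k → x ∈ nodes k b′) (sym e′) v
    ... | root    = ⊥-elim (root∉right l a b x∈)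
    ... | left v with node-bounds l a′ v | node-bounds (end l a) b x∈
    ...   | _ , p<m , m<q , q≤ | ≤p , _ =
            ⊥-elim (<⇒≱ (<-≤-trans (<-trans p<m m<q) q≤) (≤-trans (≤-reflexive (sym e′)) ≤p))
    b≡b′ : b ≡ b′
    b≡b′ = nodes-injective (end l a) b b′
             (trans e (cong (λ k → end k b′) (sym e′))) fb

  -- Membership in the lists attached to the polygon.

  ∈vertices⁺ : ∀ {n i} → 1 ≤ i → i ≤ n → i ∈ vertices n
  ∈vertices⁺ {i = suc i} _ i≤n = ∈-applyUpTo⁺ suc i≤n

  ∈vertices⁻ : ∀ {n i} → i ∈ vertices n → 1 ≤ i × i ≤ n
  ∈vertices⁻ i∈ with ∈-applyUpTo⁻ suc i∈
  ... | _ , k<n , refl = s≤s z≤n , k<n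

  vertices-unique : ∀ n → Unique (vertices n)
  vertices-unique n = Unique.applyUpTo⁺₁ suc n λ i<j _ → <⇒≢ (s<s i<j)

  diagonals-unique : ∀ n → Unique (diagonals n)
  diagonals-unique n = Unique.filter⁺ _ (Unique.filter⁺ _ (Unique.cartesianProduct⁺ (vertices-unique n) (vertices-unique n)))

  triangles-unique : ∀ n T → Unique (triangles n T)
  triangles-unique n T = Unique.filter⁺ _
    (Unique.cartesianProduct⁺ (vertices-unique n) (Unique.cartesianProduct⁺ (vertices-unique n) (vertices-unique n)))

  ∈diagonals⁺ : ∀ {n p q} → 1 ≤ p → p < q → q ≤ n → ¬ Side n (p , q) → (p , q) ∈ diagonals n
  ∈diagonals⁺ {n} 1≤p p<q q≤n ¬side =
    ∈-filter⁺ (λ s → ¬? (side? n s))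
      (∈-filter⁺ increasing?
        (∈-cartesianProduct⁺ (∈vertices⁺ 1≤p (≤-trans (<⇒≤ p<q) q≤n)) (∈vertices⁺ (≤-trans 1≤p (<⇒≤ p<q)) q≤n)) p<q)
      ¬side

  ∈diagonals⁻ : ∀ {n p q} → (p , q) ∈ diagonals n → 1 ≤ p × q ≤ n × ¬ Side n (p , q)
  ∈diagonals⁻ {n} s∈ with ∈-filter⁻ (λ s → ¬? (side? n s)) s∈
  ... | s∈′ , ¬side with ∈-cartesianProduct⁻ (vertices n) (vertices n) (proj₁ (∈-filter⁻ increasing? s∈′))
  ...   | p∈ , q∈ = proj₁ (∈vertices⁻ p∈) , proj₂ (∈vertices⁻ q∈) , ¬side

  ∈triangles⁺ : ∀ {n T l j r} → 1 ≤ l → r ≤ n → IsTriangle n T (l , j , r) → (l , j , r) ∈ triangles n T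
  ∈triangles⁺ {n} {T} 1≤l r≤n t@(l<j , j<r , _) =
    ∈-filter⁺ (isTriangle? n T)
      (∈-cartesianProduct⁺ (∈vertices⁺ 1≤l (≤-trans (<⇒≤ l<j) j≤n))
        (∈-cartesianProduct⁺ (∈vertices⁺ (≤-trans 1≤l (<⇒≤ l<j)) j≤n)
          (∈vertices⁺ (≤-trans 1≤l (<⇒≤ (<-trans l<j j<r))) r≤n)))
      t
    where j≤n = ≤-trans (<⇒≤ j<r) r≤n

  ∈triangles⁻ : ∀ {n T l j r} → (l , j , r) ∈ triangles n T → 1 ≤ l × r ≤ n × IsTriangle n T (l , j , r)
  ∈triangles⁻ {n} {T} x∈ with ∈-filter⁻ (isTriangle? n T) x∈
  ... | x∈′ , t with ∈-cartesianProduct⁻ (vertices n) _ x∈′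
  ...   | l∈ , y∈ with ∈-cartesianProduct⁻ (vertices n) (vertices n) y∈
  ...     | _ , r∈ = proj₁ (∈vertices⁻ l∈) , proj₂ (∈vertices⁻ r∈) , t

  -- Noncrossing sets and their correspondence with trees.

  noncrossing-lookup : ∀ {T s t} → NonCrossing T → s ∈ T → t ∈ T → s ≢ t → ¬ Crossing s t
  noncrossing-lookup nc s∈ t∈ s≢t with ∈-AllPairs₂ nc s∈ t∈
  ... | inj₁ eq        = ⊥-elim (s≢t eq)
  ... | inj₂ (inj₁ ¬c) = ¬c
  ... | inj₂ (inj₂ ¬c) = ¬c ∘ crossing-sym

  noncrossing-tabulate : ∀ {T} → (∀ {s t} → s ∈ T → t ∈ T → ¬ Crossing s t) → NonCrossing T
  noncrossing-tabulate {[]}    f = []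
  noncrossing-tabulate {s ∷ T} f =
    All.tabulate (λ t∈ → f (here refl) (there t∈)) ∷ noncrossing-tabulate (λ s∈ t∈ → f (there s∈) (there t∈))

  -- If j < j′ then (l , j′) and (j , r) cross.
  apex-≮ : ∀ {n T l j j′ r} → NonCrossing T → (l , j , r) ∈ triangles n T → (l , j′ , r) ∈ triangles n T → ¬ j < j′
  apex-≮ {n} {T} nc x∈ y∈ j<j′ with ∈triangles⁻ {n} {T} x∈ | ∈triangles⁻ {n} {T} y∈
  ... | 1≤l , r≤n , l<j , j<r , _ ∷ jr ∷ _ | _ , _ , l<j′ , j′<r , lj′ ∷ _ with lj′ | jr
  ...   | inj₁ (inj₁ refl)       | _                     = <⇒≱ j<j′ l<j
  ...   | inj₁ (inj₂ (_ , refl)) | _                     = <⇒≱ j′<r r≤n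
  ...   | inj₂ _                 | inj₁ (inj₁ refl)      = <⇒≱ j′<r j<j′
  ...   | inj₂ _                 | inj₁ (inj₂ (refl , _)) = <⇒≱ l<j 1≤l
  ...   | inj₂ s∈                | inj₂ t∈               =
          noncrossing-lookup nc s∈ t∈ (λ eq → <⇒≢ l<j (,-injectiveˡ eq)) (inj₁ (l<j , j<j′ , j′<r))

  apex-unique : ∀ {n T l j j′ r} → NonCrossing T → (l , j , r) ∈ triangles n T → (l , j′ , r) ∈ triangles n T → j ≡ j′
  apex-unique {n} {T} {j = j} {j′} nc x∈ y∈ with <-cmp j j′
  ... | tri< j<j′ _ _ = ⊥-elim (apex-≮ {n} {T} nc x∈ y∈ j<j′)
  ... | tri≈ _ eq _   = eq
  ... | tri> _ _ j′<j = ⊥-elim (apex-≮ {n} {T} nc y∈ x∈ j′<j)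

  -- Filtering `diagonals n`, rather than deleting the root from `chords`, makes the result
  -- literally a member of `subsets (diagonals n)`.
  diagonalsOf : ℕ → Tree → List Segment
  diagonalsOf n t = filter (_∈? chords 1 t) (diagonals n)

  module _ {n t} (n≥4 : n ≥ 4) (end≡n : end 1 t ≡ n) where

    private D = diagonalsOf n t

    root∈chords : (1 , n) ∈ chords 1 t
    root∈chords with root-link 1 t
    ... | inj₂ r∈  = subst (λ k → (1 , k) ∈ chords 1 t) end≡n r∈
    ... | inj₁ eq with s≤s (s≤s ()) ← subst (4 ≤_) (trans (sym end≡n) eq) n≥4

    edge⇒link : ∀ {s} → Edge n D s → Link 1 t s
    edge⇒link (inj₁ (inj₁ e))             = inj₁ e
    edge⇒link (inj₁ (inj₂ (refl , refl))) = inj₂ root∈chords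
    edge⇒link (inj₂ s∈)                   = inj₂ (proj₂ (∈-filter⁻ (_∈? chords 1 t) {xs = diagonals n} s∈))

    chord∈D : ∀ {s} → s ∈ chords 1 t → ¬ Side n s → s ∈ D
    chord∈D s∈ ¬side with chord-bounds 1 t s∈
    ... | 1≤p , p<q , q≤ =
      ∈-filter⁺ (_∈? chords 1 t) (∈diagonals⁺ 1≤p (<-trans (n<1+n _) p<q) (≤-trans q≤ (≤-reflexive end≡n)) ¬side) s∈

    link⇒edge : ∀ {s} → Link 1 t s → Edge n D s
    link⇒edge     (inj₁ e)  = inj₁ (inj₁ e)
    link⇒edge {s} (inj₂ s∈) with side? n s
    ... | yes side = inj₁ side
    ... | no ¬side = inj₂ (chord∈D s∈ ¬side)

    D-noncrossing : NonCrossing D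
    D-noncrossing = noncrossing-tabulate λ s∈ t∈ →
      nc (proj₂ (∈-filter⁻ (_∈? chords 1 t) {xs = diagonals n} s∈)) (proj₂ (∈-filter⁻ (_∈? chords 1 t) {xs = diagonals n} t∈))
      where
      nc : ∀ {s s′} → s ∈ chords 1 t → s′ ∈ chords 1 t → ¬ Crossing s s′
      nc s∈ s′∈ = nodes-noncrossing 1 t (proj₂ (∈chords⁻ {t = t} s∈)) (proj₂ (∈chords⁻ {t = t} s′∈))

    nodes⊆triangles : nodes 1 t ⊆ triangles n D
    nodes⊆triangles x∈ with node-bounds 1 t x∈ | node-links 1 t x∈
    ... | 1≤l , l<j , j<r , r≤ | lj , jr =
      ∈triangles⁺ 1≤l (≤-trans r≤ (≤-reflexive end≡n))
        (l<j , j<r , link⇒edge lj ∷ link⇒edge jr ∷ link⇒edge (inj₂ (∈-map⁺ base x∈)) ∷ [])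

    -- The longest side skips the apex, so it is a chord and hence the base of some node. That node
    -- is also a triangle on this side, and `apex-unique` identifies the two.
    triangles⊆nodes : triangles n D ⊆ nodes 1 t
    triangles⊆nodes {l , j , r} x∈ with ∈triangles⁻ {n} {D} x∈
    ... | _ , _ , l<j , j<r , _ ∷ _ ∷ lr ∷ [] with edge⇒link lr
    ...   | inj₁ refl = ⊥-elim (<⇒≱ j<r l<j)
    ...   | inj₂ s∈ with ∈chords⁻ {t = t} s∈
    ...     | j′ , y∈ = subst (λ k → (l , k , r) ∈ nodes 1 t) (apex-unique {n} {D} D-noncrossing (nodes⊆triangles y∈) x∈) y∈

    triangles↭nodes : triangles n D ↭ nodes 1 t
    triangles↭nodes = unique∧⊆∧⊇⇒↭ (triangles-unique n D) (nodes-unique 1 t) triangles⊆nodes nodes⊆triangles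

    size≡ : size t ≡ n ∸ 2
    size≡ = sym (cong (_∸ 2) (trans (sym end≡n) (end≡ 1 t)))

    -- Since a tree has as many chords as internal nodes, namely n - 2, this supplies the number n -
    -- 3 of diagonals.
    root∷D↭chords : (1 , n) ∷ D ↭ chords 1 t
    root∷D↭chords = unique∧⊆∧⊇⇒↭
      (All.tabulate root≢ ∷ Unique.filter⁺ _ (diagonals-unique n)) (chords-unique 1 t) to from
      where
      root≢ : ∀ {s} → s ∈ D → (1 , n) ≢ s
      root≢ s∈ refl = proj₂ (proj₂ (∈diagonals⁻ {n} (proj₁ (∈-filter⁻ (_∈? chords 1 t) s∈)))) (inj₂ (refl , refl))
      to : (1 , n) ∷ D ⊆ chords 1 t
      to (here refl) = root∈chords
      to (there s∈)  = proj₂ (∈-filter⁻ (_∈? chords 1 t) {xs = diagonals n} s∈)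
      from : chords 1 t ⊆ (1 , n) ∷ D
      from {s} s∈ with side? n s
      ... | no ¬side                   = there (chord∈D s∈ ¬side)
      ... | yes (inj₂ (refl , refl))   = here refl
      ... | yes (inj₁ refl) with chord-bounds 1 t s∈
      ...   | _ , p<q , _ = ⊥-elim (<-irrefl refl p<q)

    D-isTriangulation : IsTriangulation n D
    D-isTriangulation = cong (_∸ 1) lengthD , D-noncrossing , trans (↭-length triangles↭nodes) (trans (length-nodes 1 t) size≡)
      where
      lengthD : suc (length D) ≡ suc (n ∸ 3)
      lengthD = begin
        suc (length D)       ≡⟨ ↭-length root∷D↭chords ⟩
        length (chords 1 t)  ≡⟨ length-map base (nodes 1 t) ⟩
        length (nodes 1 t)   ≡⟨ length-nodes 1 t ⟩
        size t               ≡⟨ size≡ ⟩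
        n ∸ 2                ≡⟨ lem n≥4 ⟩
        suc (n ∸ 3)          ∎
        where
        open ≡-Reasoning
        lem : ∀ {n} → n ≥ 4 → n ∸ 2 ≡ suc (n ∸ 3)
        lem (s≤s (s≤s (s≤s _))) = refl

    diagonalsOf∈triangulations : D ∈ triangulations n
    diagonalsOf∈triangulations =
      ∈-filter⁺ (isTriangulation? n) (filter∈subsets (_∈? chords 1 t) (diagonals n)) D-isTriangulation

  diagonalsOf-injective : ∀ {n t t′} → n ≥ 4 → end 1 t ≡ n → end 1 t′ ≡ n → diagonalsOf n t ≡ diagonalsOf n t′ → t ≡ t′
  diagonalsOf-injective {n} {t} {t′} n≥4 e e′ eq = nodes-injective 1 t t′ (trans e (sym e′)) λ x∈ →
    triangles⊆nodes n≥4 e′ (subst (λ T → _ ∈ triangles n T) eq (nodes⊆triangles n≥4 e x∈))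

  -- A triangle is determined by its longest side, which is (1 , n) or a diagonal of
  -- T; there are equally many triangles, so each such segment carries a triangle.
  module _ {n T} (n≥4 : n ≥ 4) (T∈ : T ∈ triangulations n) where

    private
      T∈subsets : T ∈ subsets (diagonals n)
      T∈subsets = proj₁ (∈-filter⁻ (isTriangulation? n) T∈)
      isT : IsTriangulation n T
      isT = proj₂ (∈-filter⁻ (isTriangulation? n) {xs = subsets (diagonals n)} T∈)
      lengthT : length ((1 , n) ∷ T) ≡ n ∸ 2
      lengthT = trans (cong suc (proj₁ isT)) (lem n≥4)
        where
        lem : ∀ {n} → n ≥ 4 → suc (n ∸ 3) ≡ n ∸ 2
        lem (s≤s (s≤s (s≤s _))) = refl

    nonconsecutive-edge : ∀ {p q} → suc p < q → Edge n T (p , q) → (p , q) ∈ (1 , n) ∷ T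
    nonconsecutive-edge p<q (inj₁ (inj₁ refl))          = ⊥-elim (<-irrefl refl p<q)
    nonconsecutive-edge p<q (inj₁ (inj₂ (refl , refl))) = here refl
    nonconsecutive-edge p<q (inj₂ s∈)                   = there s∈

    bases⊆ : ∀ {x} → x ∈ triangles n T → base x ∈ (1 , n) ∷ T
    bases⊆ x∈ with ∈triangles⁻ {n} {T} x∈
    ... | _ , _ , l<j , j<r , _ ∷ _ ∷ lr ∷ [] = nonconsecutive-edge (≤-<-trans l<j j<r) lr

    edges-covered : (1 , n) ∷ T ⊆ map base (triangles n T)
    edges-covered = unique∧⊆∧length≥⇒⊇ _≟ˢ_
      (unique-map inj (triangles-unique n T)) sub
      (≤-reflexive (trans lengthT (sym (trans (length-map base (triangles n T)) (proj₂ (proj₂ isT))))))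
      where
      inj : ∀ {x y} → x ∈ triangles n T → y ∈ triangles n T → base x ≡ base y → x ≡ y
      inj {p , m , q} u v refl = cong (λ k → p , k , q) (apex-unique {n} {T} (proj₁ (proj₂ isT)) u v)
      sub : map base (triangles n T) ⊆ (1 , n) ∷ T
      sub s∈ with ∈-map⁻ base s∈
      ... | x , x∈ , refl = bases⊆ x∈

    -- The bound `k` on r - l is the recursion measure. An edge that is not a leaf has a triangle
    -- below it by `edges-covered`, whose other two sides are shorter edges.
    build : ∀ k l r → l < r → r ≤ l + k → Edge n T (l , r) →
      ∃ λ t → end l t ≡ r × nodes l t ⊆ triangles n T
    build zero l r l<r r≤ _ = ⊥-elim (<⇒≱ l<r (subst (r ≤_) (+-identityʳ l) r≤))
    build (suc k) l r l<r r≤ e with suc l ≟ r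
    ... | yes refl = leaf , refl , λ ()
    ... | no  l+1≢r with ∈-map⁻ base (edges-covered (nonconsecutive-edge (≤∧≢⇒< l<r l+1≢r) e))
    ...   | (_ , j , _) , x∈ , refl with ∈triangles⁻ {n} {T} x∈
    ...     | _ , _ , l<j , j<r , lj ∷ jr ∷ _
      with build k l j l<j (s≤s⁻¹ (≤-trans j<r (≤-trans r≤ (≤-reflexive (+-suc l k))))) lj
         | build k j r j<r (≤-trans r≤ (≤-trans (≤-reflexive (+-suc l k)) (+-monoˡ-≤ k l<j))) jr
    ...       | a , refl , a⊆ | b , refl , b⊆ = node a b , refl , sub
      where
      sub : nodes l (node a b) ⊆ triangles n T
      sub y∈ with nodeView l a b y∈
      ... | root    = x∈
      ... | left u  = a⊆ u
      ... | right v = b⊆ v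

    triangulation⇒tree : ∃ λ t → end 1 t ≡ n × T ≡ diagonalsOf n t
    triangulation⇒tree with build n 1 n (≤-trans (s≤s (s≤s z≤n)) n≥4) (n≤1+n n) (inj₁ (inj₂ (refl , refl)))
    ... | t , end≡n , t⊆ = t , end≡n , subset≡filter (_∈? chords 1 t) (diagonals-unique n) T∈subsets (T⊆chords ∘ there) from
      where
      chords⊆ : chords 1 t ⊆ (1 , n) ∷ T
      chords⊆ s∈ with ∈-map⁻ base s∈
      ... | x , x∈ , refl = bases⊆ (t⊆ x∈)
      -- Both lists have n - 2 entries, so the inclusion of the chords can be reversed.
      T⊆chords : (1 , n) ∷ T ⊆ chords 1 t
      T⊆chords = unique∧⊆∧length≥⇒⊇ _≟ˢ_ (chords-unique 1 t) chords⊆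
        (≤-reflexive (trans lengthT (sym (trans (length-map base (nodes 1 t)) (trans (length-nodes 1 t) (size≡ n≥4 end≡n))))))
      from : ∀ {s} → s ∈ diagonals n → s ∈ chords 1 t → s ∈ T
      from s∈d s∈c with chords⊆ s∈c
      ... | there s∈T = s∈T
      ... | here refl = ⊥-elim (proj₂ (proj₂ (∈diagonals⁻ {n} s∈d)) (inj₂ (refl , refl)))

  -- Enumeration of the trees by size.

  node-injective : ∀ {a b c d} → node a b ≡ node c d → a ≡ c × b ≡ d
  node-injective refl = refl , refl

  -- The recursion copies that of `conv`, so that sums over it become convolutions by a direct
  -- induction.
  convᵗ : (ℕ → List Tree) → (ℕ → List Tree) → ℕ → List Tree
  convᵗ F G zero    = cartesianProductWith node (F 0) (G 0)
  convᵗ F G (suc n) = cartesianProductWith node (F 0) (G (suc n)) ++ convᵗ (F ∘ suc) G n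

  ∈convᵗ⁺ : ∀ F G i j {a b} → a ∈ F i → b ∈ G j → node a b ∈ convᵗ F G (i + j)
  ∈convᵗ⁺ F G zero    zero    a∈ b∈ = ∈-cartesianProductWith⁺ node a∈ b∈
  ∈convᵗ⁺ F G zero    (suc j) a∈ b∈ = ∈-++⁺ˡ (∈-cartesianProductWith⁺ node a∈ b∈)
  ∈convᵗ⁺ F G (suc i) j       a∈ b∈ = ∈-++⁺ʳ (cartesianProductWith node (F 0) (G (suc (i + j)))) (∈convᵗ⁺ (F ∘ suc) G i j a∈ b∈)

  ∈convᵗ⁻ : ∀ F G n {t} → t ∈ convᵗ F G n →
    ∃₂ λ i j → ∃₂ λ a b → i + j ≡ n × a ∈ F i × b ∈ G j × t ≡ node a b
  ∈convᵗ⁻ F G zero t∈ with ∈-cartesianProductWith⁻ node (F 0) (G 0) t∈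
  ... | a , b , a∈ , b∈ , refl = 0 , 0 , a , b , refl , a∈ , b∈ , refl
  ∈convᵗ⁻ F G (suc n) t∈ with ∈-++⁻ (cartesianProductWith node (F 0) (G (suc n))) t∈
  ... | inj₁ u with ∈-cartesianProductWith⁻ node (F 0) (G (suc n)) u
  ...   | a , b , a∈ , b∈ , refl = 0 , suc n , a , b , refl , a∈ , b∈ , refl
  ∈convᵗ⁻ F G (suc n) t∈ | inj₂ v with ∈convᵗ⁻ (F ∘ suc) G n v
  ... | i , j , a , b , refl , a∈ , b∈ , refl = suc i , j , a , b , refl , a∈ , b∈ , refl

  -- The last hypothesis makes the layers of `F` disjoint, so the left child of a tree reveals which
  -- product it was formed in.
  convᵗ-unique : ∀ F G n → (∀ i → Unique (F i)) → (∀ j → Unique (G j)) →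
    (∀ i j {a} → a ∈ F i → a ∈ F j → i ≡ j) → Unique (convᵗ F G n)
  convᵗ-unique F G zero    uF uG _ = Unique.cartesianProductWith⁺ node node-injective (uF 0) (uG 0)
  convᵗ-unique F G (suc n) uF uG d = Unique.++⁺
    (Unique.cartesianProductWith⁺ node node-injective (uF 0) (uG (suc n)))
    (convᵗ-unique (F ∘ suc) G n (uF ∘ suc) uG λ i j u v → suc-injective (d (suc i) (suc j) u v))
    disjoint
    where
    disjoint : ∀ {t} → ¬ (t ∈ cartesianProductWith node (F 0) (G (suc n)) × t ∈ convᵗ (F ∘ suc) G n)
    disjoint (u , v) with ∈-cartesianProductWith⁻ node (F 0) (G (suc n)) u | ∈convᵗ⁻ (F ∘ suc) G n v
    ... | a , b , a∈ , _ , refl | i , j , _ , _ , _ , a∈′ , _ , refl with () ← d 0 (suc i) a∈ a∈′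

  -- The trees with k internal nodes, provided that k is less than the first argument.
  trees : ℕ → ℕ → List Tree
  trees zero    _       = []
  trees (suc f) zero    = leaf ∷ []
  trees (suc f) (suc k) = convᵗ (trees f) (trees f) k

  ∈trees⁻ : ∀ f k {t} → t ∈ trees f k → size t ≡ k
  ∈trees⁻ (suc f) zero    (here refl) = refl
  ∈trees⁻ (suc f) (suc k) t∈ with ∈convᵗ⁻ (trees f) (trees f) k t∈
  ... | i , j , a , b , refl , a∈ , b∈ , refl = cong suc (cong₂ _+_ (∈trees⁻ f i a∈) (∈trees⁻ f j b∈))

  ∈trees⁺ : ∀ f t → size t < f → t ∈ trees f (size t)
  ∈trees⁺ (suc f) leaf       _ = here refl
  ∈trees⁺ (suc f) (node a b) (s≤s lt) = ∈convᵗ⁺ (trees f) (trees f) (size a) (size b)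
    (∈trees⁺ f a (≤-<-trans (m≤m+n (size a) (size b)) lt))
    (∈trees⁺ f b (≤-<-trans (m≤n+m (size b) (size a)) lt))

  trees-unique : ∀ f k → Unique (trees f k)
  trees-unique zero    _       = []
  trees-unique (suc f) zero    = [] ∷ []
  trees-unique (suc f) (suc k) = convᵗ-unique (trees f) (trees f) k (trees-unique f) (trees-unique f)
    λ i j u v → trans (sym (∈trees⁻ f i u)) (∈trees⁻ f j v)

  treesOf : ℕ → List Tree
  treesOf k = trees (suc k) k

  ∈treesOf⇒end : ∀ {n t} → n ≥ 4 → t ∈ treesOf (n ∸ 2) → end 1 t ≡ n
  ∈treesOf⇒end {n} {t} n≥4 t∈ = begin
    end 1 t              ≡⟨ end≡ 1 t ⟩
    2 + size t           ≡⟨ cong (2 +_) (∈trees⁻ (suc (n ∸ 2)) (n ∸ 2) t∈) ⟩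
    2 + (n ∸ 2)          ≡⟨ m+[n∸m]≡n (≤-trans (s≤s (s≤s z≤n)) n≥4) ⟩
    n                    ∎
    where open ≡-Reasoning

  triangulations↭trees : ∀ {n} → n ≥ 4 → triangulations n ↭ map (diagonalsOf n) (treesOf (n ∸ 2))
  triangulations↭trees {n} n≥4 = unique∧⊆∧⊇⇒↭
    (Unique.filter⁺ (isTriangulation? n) (subsets-unique (diagonals-unique n)))
    (unique-map (λ u v → diagonalsOf-injective n≥4 (∈treesOf⇒end n≥4 u) (∈treesOf⇒end n≥4 v))
      (trees-unique (suc (n ∸ 2)) (n ∸ 2)))
    to from
    where
    to : triangulations n ⊆ map (diagonalsOf n) (treesOf (n ∸ 2))
    to T∈ with triangulation⇒tree n≥4 T∈
    ... | t , e , refl = ∈-map⁺ (diagonalsOf n)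
      (subst (λ k → t ∈ trees (suc k) k) (size≡ {n} {t} n≥4 e) (∈trees⁺ (suc (size t)) t ≤-refl))
    from : map (diagonalsOf n) (treesOf (n ∸ 2)) ⊆ triangulations n
    from T∈ with ∈-map⁻ (diagonalsOf n) T∈
    ... | t , t∈ , refl = diagonalsOf∈triangulations n≥4 (∈treesOf⇒end n≥4 t∈)

  -- Triangles with exactly one side on the perimeter, read off from the tree.

  leaves : Tree → ℕ
  leaves leaf       = 1
  leaves (node _ _) = 0

  is1 : ℕ → ℕ
  is1 1 = 1
  is1 _ = 0

  -- e is 1 if the base of the root is a side of the polygon, and 0 otherwise.
  oneSided : ℕ → Tree → ℕ
  oneSided e leaf       = 0
  oneSided e (node a b) = is1 (leaves a + (leaves b + e)) + (oneSided 0 a + oneSided 0 b)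

  module _ {a p} {A : Set a} {P : Pred A p} (P? : Decidable P) where

    length-filter-accept : ∀ x xs → P x → length (filter P? (x ∷ xs)) ≡ suc (length (filter P? xs))
    length-filter-accept x xs px = cong length (filter-accept P? {x} {xs} px)

    length-filter-reject : ∀ x xs → ¬ P x → length (filter P? (x ∷ xs)) ≡ length (filter P? xs)
    length-filter-reject x xs ¬px = cong length (filter-reject P? {x} {xs} ¬px)

  module _ (n : ℕ) where

    private
      sides = λ ss → length (filter (side? n) ss)
      count = λ xs → length (filter (λ x → perimeterSides n x ≟ 1) xs)

    nonroot-side : ∀ l a b → ¬ (l ≡ 1 × end l (node a b) ≡ n) → ¬ Side n (l , end l (node a b))
    nonroot-side l a b _  (inj₁ eq) = <-irrefl (sym eq) (≤-<-trans (l<end l a) (l<end (end l a) b))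
    nonroot-side l a b ¬r (inj₂ r)  = ¬r r

    -- Here `leaves t` is the indicator of a single leaf. Once (1 , n) is excluded, the segment
    -- below a subtree is a side of the polygon only in the case of a leaf.
    sides-∷ : ∀ l t ss → ¬ (l ≡ 1 × end l t ≡ n) → sides ((l , end l t) ∷ ss) ≡ leaves t + sides ss
    sides-∷ l leaf       ss ¬r = length-filter-accept (side? n) (l , suc l) ss (inj₁ refl)
    sides-∷ l (node a b) ss ¬r = length-filter-reject (side? n) (l , end l (node a b)) ss (nonroot-side l a b ¬r)

    is1-filter : ∀ x xs → count (x ∷ xs) ≡ is1 (perimeterSides n x) + count xs
    is1-filter x xs with perimeterSides n x ≟ 1
    ... | yes p = trans (length-filter-accept (λ x → perimeterSides n x ≟ 1) x xs p) (cong (λ k → is1 k + count xs) (sym p))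
    ... | no ¬p = trans (length-filter-reject (λ x → perimeterSides n x ≟ 1) x xs ¬p) (cong (_+ count xs) (sym (is1-≢ ¬p)))
      where
      is1-≢ : ∀ {k} → k ≢ 1 → is1 k ≡ 0
      is1-≢ {0} _ = refl
      is1-≢ {1} k≢1 = ⊥-elim (k≢1 refl)
      is1-≢ {suc (suc k)} _ = refl

    -- Keeping `e` abstract lets one computation serve the root, whose base is a side, and the inner
    -- nodes, whose base is a diagonal.
    count-node : ∀ e l a b → 1 ≤ l → end l (node a b) ≤ n →
      sides ((l , end l (node a b)) ∷ []) ≡ e →
      count (nodes l a) ≡ oneSided 0 a → count (nodes (end l a) b) ≡ oneSided 0 b →
      count (nodes l (node a b)) ≡ oneSided e (node a b)
    count-node e l a b 1≤l r≤n eqe eqa eqb = begin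
      count (x ∷ nodes l a ++ nodes (end l a) b)
        ≡⟨ is1-filter x (nodes l a ++ nodes (end l a) b) ⟩
      is1 (perimeterSides n x) + count (nodes l a ++ nodes (end l a) b)
        ≡⟨ cong₂ (λ i j → is1 i + j) perim count-++ ⟩
      is1 (leaves a + (leaves b + e)) + (oneSided 0 a + oneSided 0 b) ∎
      where
      open ≡-Reasoning
      x = l , end l a , end (end l a) b
      perim : perimeterSides n x ≡ leaves a + (leaves b + e)
      perim = begin
        sides ((l , end l a) ∷ (end l a , end (end l a) b) ∷ (l , end (end l a) b) ∷ [])
          ≡⟨ sides-∷ l a _ (λ (_ , eq) → <-irrefl eq (<-≤-trans (l<end (end l a) b) r≤n)) ⟩
        leaves a + sides ((end l a , end (end l a) b) ∷ (l , end (end l a) b) ∷ [])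
          ≡⟨ cong (leaves a +_) (sides-∷ (end l a) b _ (λ (eq , _) → <-irrefl (sym eq) (≤-<-trans 1≤l (l<end l a)))) ⟩
        leaves a + (leaves b + sides ((l , end (end l a) b) ∷ []))
          ≡⟨ cong (λ k → leaves a + (leaves b + k)) eqe ⟩
        leaves a + (leaves b + e) ∎
      count-++ : count (nodes l a ++ nodes (end l a) b) ≡ oneSided 0 a + oneSided 0 b
      count-++ = begin
        count (nodes l a ++ nodes (end l a) b)
          ≡⟨ cong length (filter-++ _ (nodes l a) _) ⟩
        length (filter (λ x → perimeterSides n x ≟ 1) (nodes l a) ++ filter (λ x → perimeterSides n x ≟ 1) (nodes (end l a) b))
          ≡⟨ length-++ (filter _ (nodes l a)) ⟩
        count (nodes l a) + count (nodes (end l a) b)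
          ≡⟨ cong₂ _+_ eqa eqb ⟩
        oneSided 0 a + oneSided 0 b ∎

    count-subtree : ∀ l t → 1 ≤ l → end l t ≤ n → ¬ (l ≡ 1 × end l t ≡ n) → count (nodes l t) ≡ oneSided 0 t
    count-subtree l leaf       _   _   _  = refl
    count-subtree l (node a b) 1≤l r≤n ¬r = count-node 0 l a b 1≤l r≤n
      (length-filter-reject (side? n) (l , end l (node a b)) [] (nonroot-side l a b ¬r))
      (count-subtree l a 1≤l (<⇒≤ m<n) (λ (_ , eq) → <-irrefl eq m<n))
      (count-subtree (end l a) b (<⇒≤ 1<m) r≤n (λ (eq , _) → <-irrefl (sym eq) 1<m))
      where
      m<n = <-≤-trans (l<end (end l a) b) r≤n
      1<m = ≤-<-trans 1≤l (l<end l a)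

    count-tree : ∀ t → end 1 t ≡ n → count (nodes 1 t) ≡ oneSided 1 t
    count-tree leaf       _ = refl
    count-tree (node a b) e = count-node 1 1 a b ≤-refl (≤-reflexive e)
      (length-filter-accept (side? n) (1 , end 1 (node a b)) [] (inj₂ (refl , e)))
      (count-subtree 1 a ≤-refl (<⇒≤ m<n) (λ (_ , eq) → <-irrefl eq m<n))
      (count-subtree (end 1 a) b (<⇒≤ 1<m) (≤-reflexive e) (λ (eq , _) → <-irrefl (sym eq) 1<m))
      where
      m<n = <-≤-trans (l<end (end 1 a) b) (≤-reflexive e)
      1<m = l<end 1 a

  S≡oneSided : ∀ {n t} → n ≥ 4 → end 1 t ≡ n → S n (diagonalsOf n t) ≡ oneSided 1 t
  S≡oneSided {n} {t} n≥4 e = trans (↭-length (filter-↭ _ (triangles↭nodes n≥4 e))) (count-tree n t e)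

-- Cauchy products of sequences over a commutative semiring.

module Convolutions where

  open import Algebra.Bundles using (CommutativeSemiring)
  open import Data.Nat.Base as ℕ using (ℕ; zero; suc; z≤n; s≤s; _≤_)
  import Data.Nat.Properties as ℕ
  open import Function.Base using (_∘_)
  import Algebra.Solver.Ring.NaturalCoefficients.Default as Solver

  module Convolution {c ℓ} (R : CommutativeSemiring c ℓ) where
    open CommutativeSemiring R
    open Solver R using (solve; _:=_; _:+_; _:*_; con)
    open import Relation.Binary.Reasoning.Setoid setoid

    conv : (ℕ → Carrier) → (ℕ → Carrier) → ℕ → Carrier
    conv f g zero    = f 0 * g 0
    conv f g (suc n) = f 0 * g (suc n) + conv (f ∘ suc) g n

    -- Agreement up to n must suffice, since induction hypotheses about trees are available only for
    -- smaller sizes.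
    conv-cong : ∀ {f f′ g g′} n → (∀ i → i ≤ n → f i ≈ f′ i) → (∀ j → j ≤ n → g j ≈ g′ j) →
      conv f g n ≈ conv f′ g′ n
    conv-cong zero    p q = *-cong (p 0 z≤n) (q 0 z≤n)
    conv-cong (suc n) p q = +-cong (*-cong (p 0 z≤n) (q (suc n) ℕ.≤-refl))
      (conv-cong n (λ i i≤n → p (suc i) (s≤s i≤n)) (λ j j≤n → q j (ℕ.m≤n⇒m≤1+n j≤n)))

    conv-linearˡ : ∀ a b f f′ g n → conv (λ i → a * f i + b * f′ i) g n ≈ a * conv f g n + b * conv f′ g n
    conv-linearˡ a b f f′ g zero = solve 5 (λ a b x y z → (a :* x :+ b :* y) :* z := a :* (x :* z) :+ b :* (y :* z)) refl a b (f 0) (f′ 0) (g 0)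
    conv-linearˡ a b f f′ g (suc n) = trans (+-congˡ (conv-linearˡ a b (f ∘ suc) (f′ ∘ suc) g n))
      (solve 7 (λ a b x y z u v → (a :* x :+ b :* y) :* z :+ (a :* u :+ b :* v) := a :* (x :* z :+ u) :+ b :* (y :* z :+ v))
        refl a b (f 0) (f′ 0) (g (suc n)) (conv (f ∘ suc) g n) (conv (f′ ∘ suc) g n))

    -- The mirror image of the defining recursion, from which commutativity follows.
    conv-sucʳ : ∀ f g n → conv f g (suc n) ≈ conv f (g ∘ suc) n + f (suc n) * g 0
    conv-sucʳ f g zero    = refl
    conv-sucʳ f g (suc n) = trans (+-congˡ (conv-sucʳ (f ∘ suc) g n)) (sym (+-assoc _ _ _))

    conv-comm : ∀ f g n → conv f g n ≈ conv g f n
    conv-comm f g zero    = *-comm (f 0) (g 0)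
    conv-comm f g (suc n) = begin
      f 0 * g (suc n) + conv (f ∘ suc) g n   ≈⟨ +-cong (*-comm _ _) (conv-comm (f ∘ suc) g n) ⟩
      g (suc n) * f 0 + conv g (f ∘ suc) n   ≈⟨ +-comm _ _ ⟩
      conv g (f ∘ suc) n + g (suc n) * f 0   ≈⟨ conv-sucʳ g f n ⟨
      conv g f (suc n)                       ∎

    conv-zeroˡ : ∀ f g n → (∀ i → f i ≈ 0#) → conv f g n ≈ 0#
    conv-zeroˡ f g zero    f≈0 = trans (*-congʳ (f≈0 0)) (zeroˡ _)
    conv-zeroˡ f g (suc n) f≈0 = trans (+-cong (trans (*-congʳ (f≈0 0)) (zeroˡ _)) (conv-zeroˡ (f ∘ suc) g n (f≈0 ∘ suc))) (+-identityˡ 0#)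

    δ : ℕ → Carrier
    δ zero    = 1#
    δ (suc _) = 0#

    conv-identityˡ : ∀ f n → conv δ f n ≈ f n
    conv-identityˡ f zero    = *-identityˡ _
    conv-identityˡ f (suc n) = trans (+-cong (*-identityˡ _) (conv-zeroˡ (δ ∘ suc) f n (λ _ → refl))) (+-identityʳ _)

-- Catalan numbers: exact division, ratio of neighbours, convolution.

module CatalanNumbers where

  open Convolutions
  open import Data.Nat.Base
  open import Data.Nat.Properties
  open import Data.Nat.Combinatorics
  open import Data.Nat.DivMod using (m*n/n≡m)
  open import Data.Nat.Tactic.RingSolver using (solve-∀)
  open import Function.Base using (_∘_)
  open import Relation.Binary.PropositionalEquality

  open ≡-Reasoning

  absorption : ∀ n k → suc k * (suc n C suc k) ≡ suc n * (n C k)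
  absorption zero zero    = refl
  absorption zero (suc k) = begin
    suc (suc k) * (1 C suc (suc k))  ≡⟨ cong (suc (suc k) *_) (k>n⇒nCk≡0 {1} {suc (suc k)} (s≤s (s≤s z≤n))) ⟩
    suc (suc k) * 0                  ≡⟨ *-zeroʳ (suc (suc k)) ⟩
    1 * 0                            ≡⟨ cong (1 *_) (k>n⇒nCk≡0 {0} {suc k} (s≤s z≤n)) ⟨
    1 * (0 C suc k)                  ∎
  absorption (suc n) zero = begin
    1 * (suc (suc n) C 1)     ≡⟨ cong (1 *_) (nC1≡n (suc (suc n))) ⟩
    1 * suc (suc n)           ≡⟨ *-comm 1 (suc (suc n)) ⟩
    suc (suc n) * 1           ∎
  absorption (suc n) (suc k) = begin
    suc (suc k) * (suc (suc n) C suc (suc k))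
      ≡⟨ cong (suc (suc k) *_) (nCk+nC[k+1]≡[n+1]C[k+1] (suc n) (suc k)) ⟨
    suc (suc k) * ((suc n C suc k) + (suc n C suc (suc k)))
      ≡⟨ lemma₁ (suc k) (suc n C suc k) (suc n C suc (suc k)) ⟩
    (suc n C suc k) + (suc k * (suc n C suc k) + suc (suc k) * (suc n C suc (suc k)))
      ≡⟨ cong ((suc n C suc k) +_) (cong₂ _+_ (absorption n k) (absorption n (suc k))) ⟩
    (suc n C suc k) + (suc n * (n C k) + suc n * (n C suc k))
      ≡⟨ cong ((suc n C suc k) +_) (*-distribˡ-+ (suc n) (n C k) (n C suc k)) ⟨
    (suc n C suc k) + suc n * ((n C k) + (n C suc k))
      ≡⟨ cong (λ x → (suc n C suc k) + suc n * x) (nCk+nC[k+1]≡[n+1]C[k+1] n k) ⟩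
    suc (suc n) * (suc n C suc k) ∎
    where
    lemma₁ : ∀ k x y → suc k * (x + y) ≡ x + (k * x + suc k * y)
    lemma₁ = solve-∀

  central : ℕ → ℕ
  central k = (2 * k) C k

  2*suc : ∀ k → 2 * suc k ≡ suc (suc (2 * k))
  2*suc = solve-∀

  -- (k + 1) (2k choose k + 1) = k (2k choose k), moved so that no subtraction occurs.
  central-next : ∀ k → suc k * ((2 * k) C suc k) + central k ≡ suc k * central k
  central-next k = +-cancelʳ-≡ (k * central k) _ _ (begin
    suc k * ((2 * k) C suc k) + central k + k * central k
      ≡⟨ lemma₁ k ((2 * k) C suc k) (central k) ⟩
    suc k * (central k + ((2 * k) C suc k))
      ≡⟨ cong (suc k *_) (nCk+nC[k+1]≡[n+1]C[k+1] (2 * k) k) ⟩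
    suc k * (suc (2 * k) C suc k)
      ≡⟨ absorption (2 * k) k ⟩
    suc (2 * k) * central k
      ≡⟨ lemma₂ k (central k) ⟩
    suc k * central k + k * central k ∎)
    where
    lemma₁ : ∀ k x y → suc k * x + y + k * y ≡ suc k * (y + x)
    lemma₁ = solve-∀
    lemma₂ : ∀ k y → suc (2 * k) * y ≡ suc k * y + k * y
    lemma₂ = solve-∀

  -- The division by k + 1 leaves no remainder: by `central-next` the quotient is the difference `d`
  -- of two neighbouring binomials.
  catalan-central : ∀ k → suc k * catalan k ≡ central k
  catalan-central k = begin
    suc k * (central k / suc k)          ≡⟨ cong (λ x → suc k * (x / suc k)) exact ⟩
    suc k * (d * suc k / suc k)          ≡⟨ cong (suc k *_) (m*n/n≡m d (suc k)) ⟩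
    suc k * d                            ≡⟨ *-comm (suc k) d ⟩
    d * suc k                            ≡⟨ exact ⟨
    central k ∎
    where
    d = central k ∸ ((2 * k) C suc k)
    exact : central k ≡ d * suc k
    exact = begin
      central k
        ≡⟨ m+n∸m≡n (suc k * ((2 * k) C suc k)) (central k) ⟨
      suc k * ((2 * k) C suc k) + central k ∸ suc k * ((2 * k) C suc k)
        ≡⟨ cong (_∸ suc k * ((2 * k) C suc k)) (central-next k) ⟩
      suc k * central k ∸ suc k * ((2 * k) C suc k)
        ≡⟨ *-distribˡ-∸ (suc k) (central k) ((2 * k) C suc k) ⟨
      suc k * d
        ≡⟨ *-comm (suc k) d ⟩
      d * suc k ∎

  -- Absorption is applied twice. In between, the symmetry of row 2k + 1 moves the lower index from
  -- k back up to k + 1.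
  central-suc : ∀ k → suc k * central (suc k) ≡ (4 * k + 2) * central k
  central-suc k = begin
    suc k * ((2 * suc k) C suc k)
      ≡⟨ cong (λ m → suc k * (m C suc k)) (2*suc k) ⟩
    suc k * (suc (suc (2 * k)) C suc k)
      ≡⟨ absorption (suc (2 * k)) k ⟩
    suc (suc (2 * k)) * (suc (2 * k) C k)
      ≡⟨ cong (suc (suc (2 * k)) *_) (trans (nCk≡nC[n∸k] (≤-trans (m≤m+n k _) (n≤1+n _))) (cong (suc (2 * k) C_) complement)) ⟩
    suc (suc (2 * k)) * (suc (2 * k) C suc k)
      ≡⟨ lemma₁ k (suc (2 * k) C suc k) ⟩
    2 * (suc k * (suc (2 * k) C suc k))
      ≡⟨ cong (2 *_) (absorption (2 * k) k) ⟩
    2 * (suc (2 * k) * central k)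
      ≡⟨ lemma₂ k (central k) ⟩
    (4 * k + 2) * central k ∎
    where
    lemma₁ : ∀ k x → suc (suc (2 * k)) * x ≡ 2 * (suc k * x)
    lemma₁ = solve-∀
    lemma₂ : ∀ k x → 2 * (suc (2 * k) * x) ≡ (4 * k + 2) * x
    lemma₂ = solve-∀
    lemma₃ : ∀ k → suc (2 * k) ≡ suc k + k
    lemma₃ = solve-∀
    complement : suc (2 * k) ∸ k ≡ suc k
    complement = trans (cong (_∸ k) (lemma₃ k)) (m+n∸n≡m (suc k) k)

  catalan-suc : ∀ k → (2 + k) * catalan (suc k) ≡ (4 * k + 2) * catalan k
  catalan-suc k = *-cancelˡ-≡ _ _ (suc k) (begin
    suc k * ((2 + k) * catalan (suc k))  ≡⟨ cong (suc k *_) (catalan-central (suc k)) ⟩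
    suc k * central (suc k)              ≡⟨ central-suc k ⟩
    (4 * k + 2) * central k              ≡⟨ cong ((4 * k + 2) *_) (catalan-central k) ⟨
    (4 * k + 2) * (suc k * catalan k)    ≡⟨ lemma₁ k (catalan k) ⟩
    suc k * ((4 * k + 2) * catalan k)    ∎)
    where
    lemma₁ : ∀ k x → (4 * k + 2) * (suc k * x) ≡ suc k * ((4 * k + 2) * x)
    lemma₁ = solve-∀

  open Convolution +-*-commutativeSemiring

  -- The Leibniz rule for the derivation f i ↦ i f i; the shifts a and b make the
  -- induction go through.
  conv-leibniz : ∀ a b f g n →
    conv (λ i → (i + a) * f i) g n + conv f (λ j → (j + b) * g j) n ≡ (n + a + b) * conv f g n
  conv-leibniz a b f g zero = lemma a b (f 0) (g 0)
    where
    lemma : ∀ a b x y → a * x * y + x * (b * y) ≡ (a + b) * (x * y)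
    lemma = solve-∀
  conv-leibniz a b f g (suc n) = begin
    a * f 0 * g (suc n) + conv (λ i → (suc i + a) * f (suc i)) g n
      + (f 0 * ((suc n + b) * g (suc n)) + C₂)
      ≡⟨ cong (λ C → a * f 0 * g (suc n) + C + (f 0 * ((suc n + b) * g (suc n)) + C₂))
           (conv-cong n (λ i _ → cong (_* f (suc i)) (sym (+-suc i a))) (λ _ _ → refl)) ⟩
    a * f 0 * g (suc n) + C₁ + (f 0 * ((suc n + b) * g (suc n)) + C₂)
      ≡⟨ lemma a b n (f 0) (g (suc n)) C₁ C₂ ⟩
    (suc n + a + b) * (f 0 * g (suc n)) + (C₁ + C₂)
      ≡⟨ cong ((suc n + a + b) * (f 0 * g (suc n)) +_) (conv-leibniz (suc a) b (f ∘ suc) g n) ⟩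
    (suc n + a + b) * (f 0 * g (suc n)) + (n + suc a + b) * conv (f ∘ suc) g n
      ≡⟨ lemma′ a b n (f 0 * g (suc n)) (conv (f ∘ suc) g n) ⟩
    (suc n + a + b) * (f 0 * g (suc n) + conv (f ∘ suc) g n) ∎
    where
    C₁ = conv (λ i → (i + suc a) * f (suc i)) g n
    C₂ = conv (f ∘ suc) (λ j → (j + b) * g j) n
    lemma : ∀ a b n x y u v → a * x * y + u + (x * ((suc n + b) * y) + v) ≡ (suc n + a + b) * (x * y) + (u + v)
    lemma = solve-∀
    lemma′ : ∀ a b n x y → (suc n + a + b) * x + (n + suc a + b) * y ≡ (suc n + a + b) * (x + y)
    lemma′ = solve-∀

  -- Segner's recurrence, obtained from the ratio `catalan-suc` by differentiation. If C is the
  -- Catalan series, `W` is the coefficient sequence of (x C)′, and the ratio reads W (i + 1) = 4 W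
  -- i - 2 C i. Convolving with C and using ((x C)²)′ = 2 (x C) (x C)′ expresses coefficient n + 1
  -- of C² by coefficient n and `catalan (suc n)`, which the induction hypothesis identifies.
  catalan-conv : ∀ n → conv catalan catalan n ≡ catalan (suc n)
  catalan-conv zero    = refl
  catalan-conv (suc n) = *-cancelˡ-≡ _ _ (3 + n) (begin
    (3 + n) * conv catalan catalan (suc n)   ≡⟨ twice (suc n) ⟨
    2 * (1 * 1 * c + conv (λ i → (suc i + 1) * catalan (suc i)) catalan n)
      ≡⟨ cong (λ x → 2 * (1 * 1 * c + x)) (conv-cong n (λ i _ → step i) (λ _ _ → refl)) ⟩
    2 * (1 * 1 * c + E)                      ≡⟨ cong (λ x → 2 * (1 * 1 * c + x)) E≡ ⟩
    2 * (1 * 1 * c + (2 * n + 2) * c)        ≡⟨ lemma₁ n c ⟩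
    (4 * suc n + 2) * c                      ≡⟨ catalan-suc (suc n) ⟨
    (3 + n) * catalan (suc (suc n))          ∎)
    where
    c = catalan (suc n)
    W : ℕ → ℕ
    W i = (i + 1) * catalan i
    E = conv (λ i → (4 * i + 2) * catalan i) catalan n
    twice : ∀ n → 2 * conv W catalan n ≡ (2 + n) * conv catalan catalan n
    twice n = begin
      2 * conv W catalan n                    ≡⟨ cong (λ x → conv W catalan n + x) (+-identityʳ _) ⟩
      conv W catalan n + conv W catalan n     ≡⟨ cong (conv W catalan n +_) (conv-comm W catalan n) ⟩
      conv W catalan n + conv catalan W n     ≡⟨ conv-leibniz 1 1 catalan catalan n ⟩
      (n + 1 + 1) * conv catalan catalan n    ≡⟨ cong (_* conv catalan catalan n) (trans (+-assoc n 1 1) (+-comm n 2)) ⟩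
      (2 + n) * conv catalan catalan n        ∎
    step : ∀ i → (suc i + 1) * catalan (suc i) ≡ (4 * i + 2) * catalan i
    step i = trans (cong (λ k → suc k * catalan (suc i)) (+-comm i 1)) (catalan-suc i)
    lemma₁ : ∀ n c → 2 * (1 * 1 * c + (2 * n + 2) * c) ≡ (4 * suc n + 2) * c
    lemma₁ = solve-∀
    E≡ : E ≡ (2 * n + 2) * c
    -- Adding 2 c turns the factor 4 i + 2 into 4 (i + 1), so that `E` becomes a multiple of the
    -- convolution with `W`.
    E≡ = +-cancelʳ-≡ (2 * c) _ _ (begin
      E + 2 * c
        ≡⟨ cong (λ x → E + 2 * x) (catalan-conv n) ⟨
      E + 2 * conv catalan catalan n
        ≡⟨ cong (_+ 2 * conv catalan catalan n) (sym (*-identityˡ E)) ⟩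
      1 * E + 2 * conv catalan catalan n
        ≡⟨ conv-linearˡ 1 2 (λ i → (4 * i + 2) * catalan i) catalan catalan n ⟨
      conv (λ i → 1 * ((4 * i + 2) * catalan i) + 2 * catalan i) catalan n
        ≡⟨ conv-cong n (λ i _ → lemma₂ i (catalan i)) (λ _ _ → refl) ⟩
      -- Written as a combination of two sequences so that `conv-linearˡ` extracts the factor 4.
      conv (λ i → 4 * W i + 0 * W i) catalan n
        ≡⟨ conv-linearˡ 4 0 W W catalan n ⟩
      4 * conv W catalan n + 0
        ≡⟨ lemma₃ (conv W catalan n) ⟩
      2 * (2 * conv W catalan n)
        ≡⟨ cong (2 *_) (twice n) ⟩
      2 * ((2 + n) * conv catalan catalan n)
        ≡⟨ cong (λ x → 2 * ((2 + n) * x)) (catalan-conv n) ⟩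
      2 * ((2 + n) * c)
        ≡⟨ lemma₄ n c ⟩
      (2 * n + 2) * c + 2 * c ∎)
      where
      lemma₂ : ∀ i x → 1 * ((4 * i + 2) * x) + 2 * x ≡ 4 * ((i + 1) * x) + 0 * ((i + 1) * x)
      lemma₂ = solve-∀
      lemma₃ : ∀ x → 4 * x + 0 ≡ 2 * (2 * x)
      lemma₃ = solve-∀
      lemma₄ : ∀ n c → 2 * ((2 + n) * c) ≡ (2 * n + 2) * c + 2 * c
      lemma₄ = solve-∀

-- The generating function of the weighted trees.

module GeneratingFunctions where

  open CatalanNumbers using (catalan-conv)
  open Convolutions
  open Dissections
  open import Algebra.Bundles using (CommutativeSemiring)
  open import Data.Empty using (⊥-elim)
  open import Data.List.Base using (List; []; _∷_; _++_; map; foldr; applyUpTo; upTo; cartesianProductWith)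
  open import Data.List.Membership.Propositional using (_∈_)
  open import Data.List.Relation.Unary.Any using (here; there)
  open import Data.List.Relation.Binary.Permutation.Propositional as ↭ using (_↭_)
  open import Data.Nat.Base as ℕ using (ℕ; zero; suc; z≤n; s≤s; _≤_; _<_; _∸_)
  import Data.Nat.Properties as ℕ
  open import Data.Nat.Combinatorics using (k>n⇒nCk≡0; nCk+nC[k+1]≡[n+1]C[k+1])
  open import Function.Base using (_∘_; id)
  open import Relation.Binary.PropositionalEquality as ≡ using (_≡_; _≢_)
  open import Relation.Nullary using (yes; no)
  open import Data.Nat.Combinatorics using (_C_)
  open import Data.Nat.Tactic.RingSolver using (solve-∀)
  open import Data.List.Properties using (map-applyUpTo)
  import Algebra.Properties.Semiring.Mult as Mult
  import Algebra.Properties.Semiring.Exp as Exp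
  import Algebra.Solver.Ring.NaturalCoefficients.Default as Solver

  -- The bracket in (I), with e = j + 1 and d = n - 2 - j, written without subtraction: the
  -- coefficient of x ^ d in (1 + 2 x) (1 + x) ^ e.
  numerator : ℕ → ℕ → ℕ
  numerator e zero    = 1
  numerator e (suc d) = (e C suc d) ℕ.+ 2 ℕ.* (e C d)

  numerator≡ : ∀ e d → numerator e d ℕ.+ (e C d) ≡ 2 ℕ.* (suc e C d)
  numerator≡ e zero    = ≡.refl
  numerator≡ e (suc d) = ≡.trans (lemma (e C d) (e C suc d)) (≡.cong (2 ℕ.*_) (nCk+nC[k+1]≡[n+1]C[k+1] e d))
    where
    lemma : ∀ x y → y ℕ.+ 2 ℕ.* x ℕ.+ y ≡ 2 ℕ.* (x ℕ.+ y)
    lemma = solve-∀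

  module Algebraic {c ℓ} (R : CommutativeSemiring c ℓ) where
    open CommutativeSemiring R
    open Convolution R public
    open Mult semiring using (_×_; ×-homo-+; ×1-homo-*; ×-congʳ; ×-comm-*; ×-assoc-*)
    open Exp semiring using (_^_; ^-homo-*)
    open Solver R using (solve; _:=_; _:+_; _:*_; con)
    open import Relation.Binary.Reasoning.Setoid setoid

    ∑ : {A : Set} → (A → Carrier) → List A → Carrier
    ∑ f xs = foldr _+_ 0# (map f xs)

    ∑-cong : ∀ {A : Set} {f g : A → Carrier} xs → (∀ {x} → x ∈ xs → f x ≈ g x) → ∑ f xs ≈ ∑ g xs
    ∑-cong []       _ = refl
    ∑-cong (x ∷ xs) p = +-cong (p (here ≡.refl)) (∑-cong xs (p ∘ there))

    ∑-↭ : ∀ {A : Set} (f : A → Carrier) {xs ys} → xs ↭ ys → ∑ f xs ≈ ∑ f ys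
    ∑-↭ f ↭.refl         = refl
    ∑-↭ f (↭.prep x p)   = +-congˡ (∑-↭ f p)
    ∑-↭ f (↭.swap x y p) = trans (+-congˡ (+-congˡ (∑-↭ f p)))
      (solve 3 (λ x y z → x :+ (y :+ z) := y :+ (x :+ z)) refl (f x) (f y) _)
    ∑-↭ f (↭.trans p q)  = trans (∑-↭ f p) (∑-↭ f q)

    ∑-map : ∀ {A B : Set} (f : B → Carrier) (g : A → B) xs → ∑ f (map g xs) ≡ ∑ (f ∘ g) xs
    ∑-map f g []       = ≡.refl
    ∑-map f g (x ∷ xs) = ≡.cong (f (g x) +_) (∑-map f g xs)

    ∑-++ : ∀ {A : Set} (f : A → Carrier) xs ys → ∑ f (xs ++ ys) ≈ ∑ f xs + ∑ f ys
    ∑-++ f []       ys = sym (+-identityˡ _)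
    ∑-++ f (x ∷ xs) ys = trans (+-congˡ (∑-++ f xs ys)) (sym (+-assoc _ _ _))

    ∑-+ : ∀ {A : Set} (f g : A → Carrier) xs → ∑ (λ x → f x + g x) xs ≈ ∑ f xs + ∑ g xs
    ∑-+ f g []       = sym (+-identityˡ _)
    ∑-+ f g (x ∷ xs) = trans (+-congˡ (∑-+ f g xs))
      (solve 4 (λ a b c d → (a :+ b) :+ (c :+ d) := (a :+ c) :+ (b :+ d)) refl (f x) (g x) (∑ f xs) (∑ g xs))

    ∑-* : ∀ {A : Set} a (f : A → Carrier) xs → ∑ (λ x → a * f x) xs ≈ a * ∑ f xs
    ∑-* a f []       = sym (zeroʳ a)
    ∑-* a f (x ∷ xs) = trans (+-congˡ (∑-* a f xs)) (sym (distribˡ a _ _))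

    ∑-suc : ∀ (f : ℕ → Carrier) g n → ∑ f (applyUpTo g (suc n)) ≈ ∑ f (applyUpTo g n) + f (g n)
    ∑-suc f g zero    = +-comm _ _
    ∑-suc f g (suc n) = trans (+-congˡ (∑-suc f (g ∘ suc) n)) (sym (+-assoc _ _ _))

    module _ (α β : Tree → Carrier) where

      _⊗_ : Tree → Carrier
      _⊗_ leaf       = 0#
      _⊗_ (node a b) = α a * β b

      ∑-nodes : ∀ xs ys → ∑ _⊗_ (cartesianProductWith node xs ys) ≈ ∑ α xs * ∑ β ys
      ∑-nodes []       ys = sym (zeroˡ _)
      ∑-nodes (x ∷ xs) ys = begin
        ∑ _⊗_ (map (node x) ys ++ cartesianProductWith node xs ys)
          ≈⟨ ∑-++ _⊗_ (map (node x) ys) _ ⟩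
        ∑ _⊗_ (map (node x) ys) + ∑ _⊗_ (cartesianProductWith node xs ys)
          ≈⟨ +-cong (trans (reflexive (∑-map _⊗_ (node x) ys)) (∑-* (α x) β ys)) (∑-nodes xs ys) ⟩
        α x * ∑ β ys + ∑ α xs * ∑ β ys
          ≈⟨ distribʳ _ _ _ ⟨
        (α x + ∑ α xs) * ∑ β ys ∎

      ∑-convᵗ : ∀ F G n → ∑ _⊗_ (convᵗ F G n) ≈ conv (∑ α ∘ F) (∑ β ∘ G) n
      ∑-convᵗ F G zero    = ∑-nodes (F 0) (G 0)
      ∑-convᵗ F G (suc n) = trans (∑-++ _⊗_ (cartesianProductWith node (F 0) (G (suc n))) _)
        (+-cong (∑-nodes (F 0) (G (suc n))) (∑-convᵗ (F ∘ suc) G n))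

    -- Coefficient sequences under the substitution of x (z + w x).

    module Series (z w : Carrier) where

      -- Multiplication by z + w x.
      V : (ℕ → Carrier) → ℕ → Carrier
      V f zero    = z * f 0
      V f (suc n) = z * f (suc n) + w * f n

      V-cong : ∀ {f g} n → (∀ i → i ≤ n → f i ≈ g i) → V f n ≈ V g n
      V-cong zero    p = *-congˡ (p 0 z≤n)
      V-cong (suc n) p = +-cong (*-congˡ (p (suc n) ℕ.≤-refl)) (*-congˡ (p n (ℕ.n≤1+n n)))

      V-linear : ∀ a f g n → V (λ i → a * f i + g i) n ≈ a * V f n + V g n
      V-linear a f g zero = solve 4 (λ z a x y → z :* (a :* x :+ y) := a :* (z :* x) :+ z :* y) refl z a (f 0) (g 0)
      V-linear a f g (suc n) = solve 7 (λ z w a x y u v →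
          z :* (a :* x :+ y) :+ w :* (a :* u :+ v) := a :* (z :* x :+ w :* u) :+ (z :* y :+ w :* v))
        refl z w a (f (suc n)) (g (suc n)) (f n) (g n)

      conv-Vˡ : ∀ f g n → conv (V f) g n ≈ V (conv f g) n
      conv-Vˡ f g zero    = *-assoc _ _ _
      conv-Vˡ f g (suc n) = begin
        z * f 0 * g (suc n) + conv (λ i → z * f (suc i) + w * f i) g n
          ≈⟨ +-congˡ (conv-linearˡ z w (f ∘ suc) f g n) ⟩
        z * f 0 * g (suc n) + (z * conv (f ∘ suc) g n + w * conv f g n)
          ≈⟨ solve 5 (λ z x y u v → z :* x :* y :+ (z :* u :+ v) := z :* (x :* y :+ u) :+ v) refl
               z (f 0) (g (suc n)) (conv (f ∘ suc) g n) (w * conv f g n) ⟩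
        z * (f 0 * g (suc n) + conv (f ∘ suc) g n) + w * conv f g n ∎

      conv-V : ∀ f g n → conv (V f) (V g) n ≈ V (V (conv f g)) n
      conv-V f g n = begin
        conv (V f) (V g) n   ≈⟨ conv-Vˡ f (V g) n ⟩
        V (conv f (V g)) n   ≈⟨ V-cong n (λ i _ → trans (conv-comm f (V g) i) (trans (conv-Vˡ g f i) (V-cong i (λ j _ → conv-comm g f j)))) ⟩
        V (V (conv f g)) n   ∎

      -- Substitution of x (z + w x) for x.
      comp : (ℕ → Carrier) → ℕ → Carrier
      comp c zero          = c 0
      comp c (suc zero)    = z * comp (c ∘ suc) 0
      comp c (suc (suc n)) = z * comp (c ∘ suc) (suc n) + w * comp (c ∘ suc) n

      comp-suc : ∀ c n → comp c (suc n) ≈ V (comp (c ∘ suc)) n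
      comp-suc c zero    = refl
      comp-suc c (suc n) = refl

      comp-cong : ∀ {c d} n → (∀ i → c i ≈ d i) → comp c n ≈ comp d n
      comp-cong zero          p = p 0
      comp-cong (suc zero)    p = *-congˡ (p 1)
      comp-cong (suc (suc n)) p = +-cong (*-congˡ (comp-cong (suc n) (p ∘ suc))) (*-congˡ (comp-cong n (p ∘ suc)))

      comp-linear : ∀ a c d n → comp (λ i → a * c i + d i) n ≈ a * comp c n + comp d n
      comp-linear a c d zero = refl
      comp-linear a c d (suc zero) = V-linear a (c ∘ suc) (d ∘ suc) 0
      comp-linear a c d (suc (suc n)) = trans
        (+-cong (*-congˡ (comp-linear a (c ∘ suc) (d ∘ suc) (suc n))) (*-congˡ (comp-linear a (c ∘ suc) (d ∘ suc) n)))
        (V-linear a (comp (c ∘ suc)) (comp (d ∘ suc)) (suc n))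

      -- Substitution is multiplicative: split off the constant term of `c` and apply linearity. As
      -- `V` reads coefficients n and n - 1, the hypothesis is needed at all i ≤ n, whence the
      -- induction on a bound `m`.
      comp-conv≤ : ∀ m c d n → n ≤ m → comp (conv c d) n ≈ conv (comp c) (comp d) n
      comp-conv≤ m       c d zero    _         = refl
      comp-conv≤ (suc m) c d (suc n) (s≤s n≤m) = begin
        comp (conv c d) (suc n)
          ≈⟨ comp-suc (conv c d) n ⟩
        V (comp (λ i → c 0 * d (suc i) + conv (c ∘ suc) d i)) n
          ≈⟨ V-cong n (λ i i≤n → trans (comp-linear (c 0) (d ∘ suc) (conv (c ∘ suc) d) i)
               (+-congˡ (comp-conv≤ m (c ∘ suc) d i (ℕ.≤-trans i≤n n≤m)))) ⟩
        V (λ i → c 0 * comp (d ∘ suc) i + conv (comp (c ∘ suc)) (comp d) i) n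
          ≈⟨ V-linear (c 0) (comp (d ∘ suc)) (conv (comp (c ∘ suc)) (comp d)) n ⟩
        c 0 * V (comp (d ∘ suc)) n + V (conv (comp (c ∘ suc)) (comp d)) n
          ≈⟨ +-cong (*-congˡ (sym (comp-suc d n))) (sym (conv-Vˡ (comp (c ∘ suc)) (comp d) n)) ⟩
        c 0 * comp d (suc n) + conv (V (comp (c ∘ suc))) (comp d) n
          ≈⟨ +-congˡ (conv-cong n (λ i _ → sym (comp-suc c i)) (λ _ _ → refl)) ⟩
        c 0 * comp d (suc n) + conv (comp c ∘ suc) (comp d) n ∎

      comp-conv : ∀ c d n → comp (conv c d) n ≈ conv (comp c) (comp d) n
      comp-conv c d n = comp-conv≤ n c d n ℕ.≤-refl

      -- q e d is the coefficient of x ^ d in (z + w x) ^ e.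
      q : ℕ → ℕ → Carrier
      q zero    = δ
      q (suc e) = V (q e)

      -- expand e c is the coefficient sequence of (z + w x) ^ e ∑ⱼ c j (x (z + w x)) ^ j.
      expand : ℕ → (ℕ → Carrier) → ℕ → Carrier
      expand e c zero    = c 0 * q e 0
      expand e c (suc n) = c 0 * q e (suc n) + expand (suc e) (c ∘ suc) n

      V-expand : ∀ e c n → V (expand e c) n ≈ expand (suc e) c n
      V-expand e c zero = solve 3 (λ z x y → z :* (x :* y) := x :* (z :* y)) refl z (c 0) (q e 0)
      V-expand e c (suc zero) = trans
        (solve 6 (λ z w x y u v → z :* (x :* y :+ u) :+ w :* (x :* v) := x :* (z :* y :+ w :* v) :+ z :* u) refl
          z w (c 0) (q e 1) (expand (suc e) (c ∘ suc) 0) (q e 0))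
        (+-congˡ (V-expand (suc e) (c ∘ suc) 0))
      V-expand e c (suc (suc n)) = trans
        (solve 7 (λ z w x y u v t → z :* (x :* y :+ u) :+ w :* (x :* v :+ t) := x :* (z :* y :+ w :* v) :+ (z :* u :+ w :* t)) refl
          z w (c 0) (q e (suc (suc n))) (expand (suc e) (c ∘ suc) (suc n)) (q e (suc n)) (expand (suc e) (c ∘ suc) n))
        (+-congˡ (V-expand (suc e) (c ∘ suc) (suc n)))

      comp≈expand≤ : ∀ m c n → n ≤ m → comp c n ≈ expand 0 c n
      comp≈expand≤ m       c zero    _         = sym (*-identityʳ _)
      comp≈expand≤ (suc m) c (suc n) (s≤s n≤m) = begin
        comp c (suc n)                            ≈⟨ comp-suc c n ⟩
        V (comp (c ∘ suc)) n                      ≈⟨ V-cong n (λ i i≤n → comp≈expand≤ m (c ∘ suc) i (ℕ.≤-trans i≤n n≤m)) ⟩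
        V (expand 0 (c ∘ suc)) n                  ≈⟨ V-expand 0 (c ∘ suc) n ⟩
        expand 1 (c ∘ suc) n                      ≈⟨ +-identityˡ _ ⟨
        0# + expand 1 (c ∘ suc) n                 ≈⟨ +-congʳ (zeroʳ (c 0)) ⟨
        c 0 * 0# + expand 1 (c ∘ suc) n           ∎

      comp≈expand : ∀ c n → comp c n ≈ expand 0 c n
      comp≈expand c n = comp≈expand≤ n c n ℕ.≤-refl

      cat : ℕ → Carrier
      cat j = catalan j × 1#

      ×1-conv : ∀ (f g : ℕ → ℕ) n → Convolution.conv ℕ.+-*-commutativeSemiring f g n × 1# ≈ conv (λ i → f i × 1#) (λ j → g j × 1#) n
      ×1-conv f g zero    = ×1-homo-* (f 0) (g 0)
      ×1-conv f g (suc n) = trans (×-homo-+ 1# (f 0 ℕ.* g (suc n)) _) (+-cong (×1-homo-* (f 0) (g (suc n))) (×1-conv (f ∘ suc) g n))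

      cat-conv : ∀ n → conv cat cat n ≈ cat (suc n)
      cat-conv n = trans (sym (×1-conv catalan catalan n)) (reflexive (≡.cong (_× 1#) (catalan-conv n)))

      F : ℕ → Carrier
      F = comp cat

      -- The Catalan equation C = 1 + x C² after the substitution, that is, F = 1 + x (z + w x) F².
      F-suc : ∀ n → F (suc n) ≈ V (conv F F) n
      F-suc n = trans (comp-suc cat n) (V-cong n λ i _ →
        trans (comp-cong i (λ j → sym (cat-conv j))) (comp-conv cat cat i))

      -- The series H divided by x: the index now counts internal nodes, one fewer than the leaves.
      h : ℕ → Carrier
      h = V F

      -- Multiplying the equation of F by z + w x gives h = z + w x + x h², whose linear part only
      -- reaches the indices 0 and 1.
      h-conv : ∀ n → h (suc (suc n)) ≈ conv h h (suc n)
      h-conv n = begin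
        z * F (suc (suc n)) + w * F (suc n)   ≈⟨ +-cong (*-congˡ (F-suc (suc n))) (*-congˡ (F-suc n)) ⟩
        V (V (conv F F)) (suc n)              ≈⟨ conv-V F F (suc n) ⟨
        conv h h (suc n)                      ∎

      h≈expand : ∀ n → h n ≈ expand 1 cat n
      h≈expand n = trans (V-cong n (λ i _ → comp≈expand cat i)) (V-expand 0 cat n)

      module _ (z²+w≈1 : z * z + w ≈ 1#) where

        -- The value matches the tree with two leaves: its triangle has two sides on the perimeter
        -- when it is not the root, so its weight is 1, while two leaves multiply to z².
        h1≈1 : h 1 ≈ 1#
        h1≈1 = trans (solve 2 (λ z w → z :* (z :* (con 1 :+ con 0)) :+ w :* (con 1 :+ con 0) := z :* z :+ w) refl z w) z²+w≈1

        -- Weights of trees and their sums.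

        φ : ℕ → Tree → Carrier
        φ e t = z ^ oneSided e t

        -- A leaf is given weight z, so that the weight is multiplicative.
        φ′ : Tree → Carrier
        φ′ leaf         = z
        φ′ t@(node _ _) = φ 0 t

        leaf? : Tree → Carrier
        leaf? leaf       = 1#
        leaf? (node _ _) = 0#

        φ′-node : ∀ t → size t ≢ 1 → size t ≢ 0 → φ′ t ≈ (φ′ ⊗ φ′) t
        φ′-node leaf                              _   s≢0 = ⊥-elim (s≢0 ≡.refl)
        φ′-node (node leaf leaf)                  s≢1 _ = ⊥-elim (s≢1 ≡.refl)
        φ′-node (node leaf (node _ _))            _   _ = refl
        φ′-node (node t@(node _ _) leaf)          _   _ = trans (*-congˡ (reflexive (≡.cong (z ^_) (ℕ.+-identityʳ (oneSided 0 t))))) (*-comm _ _)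
        φ′-node (node t@(node _ _) t′@(node _ _)) _   _ = ^-homo-* z (oneSided 0 t) (oneSided 0 t′)

        -- The base of the root is a side. Without a leaf child the root counts and contributes z.
        -- With one leaf child it has two sides on the perimeter and contributes 1, while the first
        -- summand gives z for the root and z for the leaf; the missing 1 - z² is the `leaf?` term.
        φ-root : ∀ t → size t ≢ 1 → size t ≢ 0 →
          φ 1 t ≈ z * (φ′ ⊗ φ′) t + (w * (leaf? ⊗ φ′) t + w * (φ′ ⊗ leaf?) t)
        φ-root leaf                              _   s≢0 = ⊥-elim (s≢0 ≡.refl)
        φ-root (node leaf leaf)                  s≢1 _ = ⊥-elim (s≢1 ≡.refl)
        φ-root (node leaf t@(node _ _))          _   _ = begin
          φ 0 t
            ≈⟨ *-identityˡ _ ⟨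
          1# * φ 0 t
            ≈⟨ *-congʳ z²+w≈1 ⟨
          (z * z + w) * φ 0 t
            ≈⟨ solve 3 (λ z w x → (z :* z :+ w) :* x := z :* (z :* x) :+ (w :* (con 1 :* x) :+ w :* (z :* con 0))) refl z w (φ 0 t) ⟩
          z * (z * φ 0 t) + (w * (1# * φ 0 t) + w * (z * 0#)) ∎
        φ-root (node t@(node _ _) leaf)          _   _ = begin
          z ^ (oneSided 0 t ℕ.+ 0)
            ≈⟨ reflexive (≡.cong (z ^_) (ℕ.+-identityʳ (oneSided 0 t))) ⟩
          φ 0 t
            ≈⟨ *-identityˡ _ ⟨
          1# * φ 0 t
            ≈⟨ *-congʳ z²+w≈1 ⟨
          (z * z + w) * φ 0 t
            ≈⟨ solve 3 (λ z w x → (z :* z :+ w) :* x := z :* (x :* z) :+ (w :* (con 0 :* z) :+ w :* (x :* con 1))) refl z w (φ 0 t) ⟩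
          z * (φ 0 t * z) + (w * (0# * z) + w * (φ 0 t * 1#)) ∎
        φ-root (node t@(node _ _) t′@(node _ _)) _   _ = begin
          z * z ^ (oneSided 0 t ℕ.+ oneSided 0 t′)
            ≈⟨ *-congˡ (^-homo-* z (oneSided 0 t) (oneSided 0 t′)) ⟩
          z * (φ 0 t * φ 0 t′)
            ≈⟨ solve 4 (λ z w x y → z :* (x :* y) := z :* (x :* y) :+ (w :* (con 0 :* y) :+ w :* (x :* con 0))) refl z w (φ 0 t) (φ 0 t′) ⟩
          z * (φ 0 t * φ 0 t′) + (w * (0# * φ 0 t′) + w * (φ 0 t * 0#)) ∎

        ∑-trees : ∀ f k → k < f → ∑ φ′ (trees f k) ≈ h k
        ∑-trees (suc f) zero          _ = trans (+-identityʳ z) (sym (trans (*-congˡ (+-identityʳ 1#)) (*-identityʳ z)))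
        ∑-trees (suc (suc f)) (suc zero)    _ = trans (+-identityʳ 1#) (sym h1≈1)
        ∑-trees (suc f) (suc (suc k)) (s≤s k<f) = begin
          ∑ φ′ (trees (suc f) (suc (suc k)))
            ≈⟨ ∑-cong (trees (suc f) (suc (suc k))) (λ {t} t∈ → φ′-node t (λ e → 2+≢1 (≡.trans (≡.sym (∈trees⁻ (suc f) (suc (suc k)) t∈)) e))
                 (λ e → 2+≢0 (≡.trans (≡.sym (∈trees⁻ (suc f) (suc (suc k)) t∈)) e))) ⟩
          ∑ (φ′ ⊗ φ′) (trees (suc f) (suc (suc k)))
            ≈⟨ ∑-convᵗ φ′ φ′ (trees f) (trees f) (suc k) ⟩
          conv (∑ φ′ ∘ trees f) (∑ φ′ ∘ trees f) (suc k)
            ≈⟨ conv-cong (suc k) IH IH ⟩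
          conv h h (suc k)
            ≈⟨ h-conv k ⟨
          h (suc (suc k)) ∎
          where
          2+≢1 : suc (suc k) ≢ 1
          2+≢1 ()
          2+≢0 : suc (suc k) ≢ 0
          2+≢0 ()
          IH : ∀ i → i ≤ suc k → ∑ φ′ (trees f i) ≈ h i
          IH i i≤ = ∑-trees f i (ℕ.≤-<-trans i≤ k<f)

        ∑-leaf? : ∀ f k → k < f → ∑ leaf? (trees f k) ≈ δ k
        ∑-leaf? (suc f) zero    _ = +-identityʳ 1#
        ∑-leaf? (suc f) (suc k) _ = trans (∑-cong (trees (suc f) (suc k)) (λ {t} t∈ → nonleaf t (∈trees⁻ (suc f) (suc k) t∈)))
          (∑-zero (trees (suc f) (suc k)))
          where
          nonleaf : ∀ t {k} → size t ≡ suc k → leaf? t ≈ 0#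
          nonleaf (node _ _) _ = refl
          ∑-zero : ∀ (xs : List Tree) → ∑ (λ _ → 0#) xs ≈ 0#
          ∑-zero []       = refl
          ∑-zero (_ ∷ xs) = trans (+-identityˡ _) (∑-zero xs)

        -- The series of `leaf?` is the constant 1, so each correction in `φ-root` convolves to a
        -- shift of `h`. Together this is a coefficient of (z + 2 w x) h.
        ∑-root : ∀ k → ∑ (φ 1) (treesOf (2 ℕ.+ k)) ≈ z * h (2 ℕ.+ k) + (w * h (suc k) + w * h (suc k))
        ∑-root k = begin
          ∑ (φ 1) ts
            ≈⟨ ∑-cong ts (λ {t} t∈ → φ-root t
                 (λ e → 2+≢1 (≡.trans (≡.sym (∈trees⁻ f (2 ℕ.+ k) t∈)) e))
                 (λ e → 2+≢0 (≡.trans (≡.sym (∈trees⁻ f (2 ℕ.+ k) t∈)) e))) ⟩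
          ∑ (λ t → z * (φ′ ⊗ φ′) t + (w * (leaf? ⊗ φ′) t + w * (φ′ ⊗ leaf?) t)) ts
            ≈⟨ trans (∑-+ _ _ ts) (+-cong (∑-* z (φ′ ⊗ φ′) ts) (trans (∑-+ _ _ ts)
                 (+-cong (∑-* w (leaf? ⊗ φ′) ts) (∑-* w (φ′ ⊗ leaf?) ts)))) ⟩
          z * ∑ (φ′ ⊗ φ′) ts + (w * ∑ (leaf? ⊗ φ′) ts + w * ∑ (φ′ ⊗ leaf?) ts)
            ≈⟨ +-cong (*-congˡ (trans (∑-convᵗ φ′ φ′ T T (suc k)) (trans (conv-cong (suc k) Hφ Hφ) (sym (h-conv k)))))
                 (+-cong (*-congˡ (trans (∑-convᵗ leaf? φ′ T T (suc k)) (trans (conv-cong (suc k) Hδ Hφ) (conv-identityˡ h (suc k)))))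
                   (*-congˡ (trans (∑-convᵗ φ′ leaf? T T (suc k)) (trans (conv-cong (suc k) Hφ Hδ)
                     (trans (conv-comm h δ (suc k)) (conv-identityˡ h (suc k))))))) ⟩
          z * h (2 ℕ.+ k) + (w * h (suc k) + w * h (suc k)) ∎
          where
          f = 3 ℕ.+ k
          T = trees (2 ℕ.+ k)
          ts = treesOf (2 ℕ.+ k)
          2+≢1 : suc (suc k) ≢ 1
          2+≢1 ()
          2+≢0 : suc (suc k) ≢ 0
          2+≢0 ()
          Hφ : ∀ i → i ≤ suc k → ∑ φ′ (T i) ≈ h i
          Hφ i i≤ = ∑-trees (2 ℕ.+ k) i (s≤s i≤)
          Hδ : ∀ i → i ≤ suc k → ∑ leaf? (T i) ≈ δ i
          Hδ i i≤ = ∑-leaf? (2 ℕ.+ k) i (s≤s i≤)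

      -- The truncated exponents differ by one only if d ≤ e; beyond that the binomial vanishes on
      -- both sides.
      z*q : ∀ e d → z * ((e C d) × (z ^ (e ∸ d) * w ^ d)) ≈ (e C d) × (z ^ (suc e ∸ d) * w ^ d)
      z*q e d with d ℕ.≤? e
      ... | yes d≤e = begin
        z * ((e C d) × (z ^ (e ∸ d) * w ^ d))   ≈⟨ ×-comm-* (e C d) z _ ⟩
        (e C d) × (z * (z ^ (e ∸ d) * w ^ d))   ≈⟨ ×-congʳ (e C d) (*-assoc _ _ _) ⟨
        (e C d) × (z ^ suc (e ∸ d) * w ^ d)     ≡⟨ ≡.cong (λ i → (e C d) × (z ^ i * w ^ d)) (ℕ.+-∸-assoc 1 d≤e) ⟨
        (e C d) × (z ^ (suc e ∸ d) * w ^ d)     ∎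
      ... | no d≰e = begin
        z * ((e C d) × (z ^ (e ∸ d) * w ^ d))   ≡⟨ ≡.cong (λ i → z * (i × (z ^ (e ∸ d) * w ^ d))) eCd≡0 ⟩
        z * 0#                                  ≈⟨ zeroʳ z ⟩
        0#                                      ≡⟨ ≡.cong (_× (z ^ (suc e ∸ d) * w ^ d)) eCd≡0 ⟨
        (e C d) × (z ^ (suc e ∸ d) * w ^ d)     ∎
        where eCd≡0 = k>n⇒nCk≡0 (ℕ.≰⇒> d≰e)

      w*q : ∀ e d → w * ((e C d) × (z ^ (e ∸ d) * w ^ d)) ≈ (e C d) × (z ^ (e ∸ d) * w ^ suc d)
      w*q e d = trans (×-comm-* (e C d) w _)
        (×-congʳ (e C d) (solve 3 (λ w x y → w :* (x :* y) := x :* (w :* y)) refl w (z ^ (e ∸ d)) (w ^ d)))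

      q-binomial : ∀ e d → q e d ≈ (e C d) × (z ^ (e ∸ d) * w ^ d)
      q-binomial zero    zero    = sym (trans (+-identityʳ _) (*-identityˡ 1#))
      q-binomial zero    (suc d) = reflexive (≡.sym (≡.cong (_× (1# * w ^ suc d)) (k>n⇒nCk≡0 {0} {suc d} (s≤s z≤n))))
      q-binomial (suc e) zero    = trans (*-congˡ (q-binomial e 0)) (z*q e 0)
      q-binomial (suc e) (suc d) = begin
        z * q e (suc d) + w * q e d
          ≈⟨ +-cong (trans (*-congˡ (q-binomial e (suc d))) (z*q e (suc d))) (trans (*-congˡ (q-binomial e d)) (w*q e d)) ⟩
        (e C suc d) × X + (e C d) × X
          ≈⟨ +-comm _ _ ⟩
        (e C d) × X + (e C suc d) × X
          ≈⟨ ×-homo-+ X (e C d) (e C suc d) ⟨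
        ((e C d) ℕ.+ (e C suc d)) × X
          ≡⟨ ≡.cong (_× X) (nCk+nC[k+1]≡[n+1]C[k+1] e d) ⟩
        (suc e C suc d) × X ∎
        where X = z ^ (e ∸ d) * w ^ suc d

      -- t e d is the coefficient of x ^ d in (z + 2 w x) (z + w x) ^ e.
      t : ℕ → ℕ → Carrier
      t e zero    = z * q e 0
      t e (suc d) = z * q e (suc d) + (w * q e d + w * q e d)

      t-numerator : ∀ e d → t e d ≈ numerator e d × (z ^ (suc e ∸ d) * w ^ d)
      t-numerator e zero    = trans (*-congˡ (q-binomial e 0)) (z*q e 0)
      t-numerator e (suc d) = begin
        z * q e (suc d) + (w * q e d + w * q e d)
          ≈⟨ +-cong (trans (*-congˡ (q-binomial e (suc d))) (z*q e (suc d))) (+-cong w*q′ w*q′) ⟩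
        (e C suc d) × X + ((e C d) × X + (e C d) × X)
          ≈⟨ +-congˡ (+-congˡ (+-identityʳ _)) ⟨
        (e C suc d) × X + ((e C d) × X + ((e C d) × X + 0 × X))
          ≈⟨ +-congˡ (trans (+-congˡ (sym (×-homo-+ X (e C d) 0))) (sym (×-homo-+ X (e C d) _))) ⟩
        (e C suc d) × X + (2 ℕ.* (e C d)) × X
          ≈⟨ ×-homo-+ X (e C suc d) _ ⟨
        numerator e (suc d) × X ∎
        where
        X = z ^ (e ∸ d) * w ^ suc d
        w*q′ = trans (*-congˡ (q-binomial e d)) (w*q e d)

      -- As `expand`, with the root factor z + 2 w x multiplied into every power of z + w x.
      expandᵗ : ℕ → (ℕ → Carrier) → ℕ → Carrier
      expandᵗ e c zero    = c 0 * t e 0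
      expandᵗ e c (suc n) = c 0 * t e (suc n) + expandᵗ (suc e) (c ∘ suc) n

      expand-t : ∀ e c n → z * expand e c (suc n) + (w * expand e c n + w * expand e c n) ≈ expandᵗ e c (suc n)
      expand-t e c zero = solve 7 (λ z w x y u v s → z :* (x :* y :+ u :* v) :+ (w :* (x :* s) :+ w :* (x :* s))
            := x :* (z :* y :+ (w :* s :+ w :* s)) :+ u :* (z :* v)) refl
          z w (c 0) (q e 1) (c 1) (q (suc e) 0) (q e 0)
      expand-t e c (suc n) = trans
        (solve 7 (λ z w x y u v s → z :* (x :* y :+ u) :+ (w :* (x :* v :+ s) :+ w :* (x :* v :+ s))
            := x :* (z :* y :+ (w :* v :+ w :* v)) :+ (z :* u :+ (w :* s :+ w :* s))) refl
          z w (c 0) (q e (suc (suc n))) (expand (suc e) (c ∘ suc) (suc n)) (q e (suc n)) (expand (suc e) (c ∘ suc) n))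
        (+-congˡ (expand-t (suc e) (c ∘ suc) n))

      expandᵗ≈∑ : ∀ e c n → expandᵗ e c n ≈ ∑ (λ j → c j * t (j ℕ.+ e) (n ∸ j)) (upTo (suc n))
      expandᵗ≈∑ e c zero    = sym (+-identityʳ _)
      expandᵗ≈∑ e c (suc n) = +-congˡ (begin
        expandᵗ (suc e) (c ∘ suc) n
          ≈⟨ expandᵗ≈∑ (suc e) (c ∘ suc) n ⟩
        ∑ (λ j → c (suc j) * t (j ℕ.+ suc e) (n ∸ j)) (upTo (suc n))
          ≈⟨ ∑-cong (upTo (suc n)) (λ {j} _ → reflexive (≡.cong (λ i → c (suc j) * t i (n ∸ j)) (ℕ.+-suc j e))) ⟩
        ∑ (f ∘ suc) (upTo (suc n))
          ≡⟨ ≡.cong (foldr _+_ 0#) (≡.trans (map-applyUpTo id (f ∘ suc) (suc n)) (≡.sym (map-applyUpTo suc f (suc n)))) ⟩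
        ∑ f (applyUpTo suc (suc n)) ∎)
        where
        f : ℕ → Carrier
        f j = c j * t (j ℕ.+ e) (suc n ∸ j)

      -- The summand of (I) for a polygon with n + 2 vertices; `n` is the number of its triangles.
      term : ℕ → ℕ → Carrier
      term n j = (catalan j ℕ.* numerator (j ℕ.+ 1) (n ∸ j)) × 1# * (z ^ (suc (j ℕ.+ 1) ∸ (n ∸ j)) * w ^ (n ∸ j))

      -- This is (I) cleared of its denominator, in a form that applies to the algebra of the
      -- theorem and to jets alike.
      ∑-root≈∑-term : z * z + w ≈ 1# → ∀ k →
        ∑ (λ t → z ^ oneSided 1 t) (treesOf (2 ℕ.+ k)) ≈ ∑ (term (2 ℕ.+ k)) (upTo (3 ℕ.+ k))
      ∑-root≈∑-term z²+w≈1 k = begin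
        ∑ (φ z²+w≈1 1) (treesOf (2 ℕ.+ k))
          ≈⟨ ∑-root z²+w≈1 k ⟩
        z * h (2 ℕ.+ k) + (w * h (suc k) + w * h (suc k))
          ≈⟨ +-cong (*-congˡ (h≈expand (2 ℕ.+ k))) (+-cong (*-congˡ (h≈expand (suc k))) (*-congˡ (h≈expand (suc k)))) ⟩
        z * expand 1 cat (2 ℕ.+ k) + (w * expand 1 cat (suc k) + w * expand 1 cat (suc k))
          ≈⟨ expand-t 1 cat (suc k) ⟩
        expandᵗ 1 cat (2 ℕ.+ k)
          ≈⟨ expandᵗ≈∑ 1 cat (2 ℕ.+ k) ⟩
        ∑ (λ j → cat j * t (j ℕ.+ 1) (2 ℕ.+ k ∸ j)) (upTo (3 ℕ.+ k))
          ≈⟨ ∑-cong (upTo (3 ℕ.+ k)) (λ {j} _ → termwise j (2 ℕ.+ k ∸ j)) ⟩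
        ∑ (term (2 ℕ.+ k)) (upTo (3 ℕ.+ k)) ∎
        where
        termwise : ∀ j d → cat j * t (j ℕ.+ 1) d ≈
          (catalan j ℕ.* numerator (j ℕ.+ 1) d) × 1# * (z ^ (suc (j ℕ.+ 1) ∸ d) * w ^ d)
        termwise j d = begin
          cat j * t (j ℕ.+ 1) d                 ≈⟨ *-congˡ (t-numerator (j ℕ.+ 1) d) ⟩
          cat j * (N × X)                       ≈⟨ *-congˡ (×-congʳ N (*-identityˡ X)) ⟨
          cat j * (N × (1# * X))                ≈⟨ *-congˡ (×-assoc-* N 1# X) ⟨
          cat j * (N × 1# * X)                  ≈⟨ *-assoc _ _ _ ⟨
          cat j * N × 1# * X                    ≈⟨ *-congʳ (×1-homo-* (catalan j) N) ⟨
          (catalan j ℕ.* N) × 1# * X            ∎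
          where
          N = numerator (j ℕ.+ 1) d
          X = z ^ (suc (j ℕ.+ 1) ∸ d) * w ^ d

-- First and second moments by jets of order two.

module Moments where

  open CatalanNumbers using (absorption; catalan-suc)
  open Dissections using (oneSided; treesOf)
  open GeneratingFunctions
  open import Algebra.Bundles using (CommutativeSemiring)
  open import Algebra.Structures.Biased using (isCommutativeSemiringˡ; isCommutativeMonoidˡ)
  open import Data.Integer.Base hiding (_^_; suc)
  open import Data.Integer.Properties
  open import Data.Integer.Tactic.RingSolver using (solve-∀)
  open import Data.List.Base using (List; []; _∷_; length; upTo; foldr; map)
  import Data.Nat.Base as ℕ
  open ℕ using (ℕ; zero; suc)
  import Data.Nat.Properties as ℕ
  import Data.Nat.Tactic.RingSolver as ℕ
  open import Data.Nat.Combinatorics using (_C_; nC1≡n)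
  open import Data.Product.Base using (_×_; _,_; proj₁; proj₂)
  open import Function.Base using (_∘_; id)
  open import Level using (0ℓ)
  open import Relation.Binary.PropositionalEquality
  open import Algebra.Definitions {A = ℤ × ℤ × ℤ} _≡_

  -- The triple (f , f′ , f″) of a function and its first two derivatives at a point,
  -- multiplied by the Leibniz rule; z = eˣ at x = 0 has powers (1 , k , k²).

  Jet : Set
  Jet = ℤ × ℤ × ℤ

  infixl 6 _+ᴶ_
  infixl 7 _*ᴶ_

  _+ᴶ_ _*ᴶ_ : Jet → Jet → Jet
  (a , b , c) +ᴶ (a′ , b′ , c′) = a + a′ , b + b′ , c + c′
  (a , b , c) *ᴶ (a′ , b′ , c′) = a * a′ , a * b′ + b * a′ , a * c′ + + 2 * b * b′ + c * a′

  0ᴶ 1ᴶ : Jet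
  0ᴶ = 0ℤ , 0ℤ , 0ℤ
  1ᴶ = 1ℤ , 0ℤ , 0ℤ

  triple : ∀ {a b c a′ b′ c′ : ℤ} → a ≡ a′ → b ≡ b′ → c ≡ c′ → (a , b , c) ≡ (a′ , b′ , c′)
  triple refl refl refl = refl

  *ᴶ-assoc : Associative _*ᴶ_
  *ᴶ-assoc (a , b , c) (d , e , f) (g , h , i) = triple (*-assoc a d g) (l₁ a b d e g h) (l₂ a b c d e f g h i)
    where
    l₁ : ∀ a b d e g h → a * d * h + (a * e + b * d) * g ≡ a * (d * h + e * g) + b * (d * g)
    l₁ = solve-∀
    l₂ : ∀ a b c d e f g h i → a * d * i + + 2 * (a * e + b * d) * h + (a * f + + 2 * b * e + c * d) * g
       ≡ a * (d * i + + 2 * e * h + f * g) + + 2 * b * (d * h + e * g) + c * (d * g)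
    l₂ = solve-∀

  *ᴶ-comm : Commutative _*ᴶ_
  *ᴶ-comm (a , b , c) (d , e , f) = triple (*-comm a d) (l₁ a b d e) (l₂ a b c d e f)
    where
    l₁ : ∀ a b d e → a * e + b * d ≡ d * b + e * a
    l₁ = solve-∀
    l₂ : ∀ a b c d e f → a * f + + 2 * b * e + c * d ≡ d * c + + 2 * e * b + f * a
    l₂ = solve-∀

  *ᴶ-identityˡ : LeftIdentity 1ᴶ _*ᴶ_
  *ᴶ-identityˡ (a , b , c) = triple (*-identityˡ a) (l₁ a b) (l₂ a b c)
    where
    l₁ : ∀ a b → 1ℤ * b + 0ℤ * a ≡ b
    l₁ = solve-∀
    l₂ : ∀ a b c → 1ℤ * c + + 2 * 0ℤ * b + 0ℤ * a ≡ c
    l₂ = solve-∀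

  *ᴶ-distribʳ-+ᴶ : _*ᴶ_ DistributesOverʳ _+ᴶ_
  *ᴶ-distribʳ-+ᴶ (a , b , c) (d , e , f) (g , h , i) = triple (*-distribʳ-+ a d g) (l₁ a b d e g h) (l₂ a b c d e f g h i)
    where
    l₁ : ∀ a b d e g h → (d + g) * b + (e + h) * a ≡ d * b + e * a + (g * b + h * a)
    l₁ = solve-∀
    l₂ : ∀ a b c d e f g h i → (d + g) * c + + 2 * (e + h) * b + (f + i) * a
       ≡ d * c + + 2 * e * b + f * a + (g * c + + 2 * h * b + i * a)
    l₂ = solve-∀

  jets : CommutativeSemiring 0ℓ 0ℓ
  jets = record
    { Carrier = Jet ; _≈_ = _≡_ ; _+_ = _+ᴶ_ ; _*_ = _*ᴶ_ ; 0# = 0ᴶ ; 1# = 1ᴶ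
    ; isCommutativeSemiring = isCommutativeSemiringˡ record
      { +-isCommutativeMonoid = isCommutativeMonoidˡ record
        { isSemigroup = record
          { isMagma = record { isEquivalence = isEquivalence ; ∙-cong = cong₂ _+ᴶ_ }
          ; assoc   = λ (a , b , c) (d , e , f) (g , h , i) → triple (+-assoc a d g) (+-assoc b e h) (+-assoc c f i) }
        ; identityˡ = λ (a , b , c) → triple (+-identityˡ a) (+-identityˡ b) (+-identityˡ c)
        ; comm      = λ (a , b , c) (d , e , f) → triple (+-comm a d) (+-comm b e) (+-comm c f) }
      ; *-isCommutativeMonoid = isCommutativeMonoidˡ record
        { isSemigroup = record
          { isMagma = record { isEquivalence = isEquivalence ; ∙-cong = cong₂ _*ᴶ_ }
          ; assoc   = *ᴶ-assoc }
        ; identityˡ = *ᴶ-identityˡ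
        ; comm      = *ᴶ-comm }
      ; distribʳ = *ᴶ-distribʳ-+ᴶ
      ; zeroˡ    = λ _ → refl
      }
    }

  open Algebraic jets using (module Series; ∑; ∑-suc; ∑-cong)
  open CommutativeSemiring jets using (semiring; zeroʳ)
  open import Algebra.Properties.Semiring.Mult semiring using () renaming (_×_ to _·_)
  open import Algebra.Properties.Semiring.Exp semiring using (_^_)

  -- `wᴶ` is the jet of 1 - e²ˣ at x = 0, as w = 1 - z² and z = eˣ.
  zᴶ wᴶ : Jet
  zᴶ = 1ℤ , 1ℤ , 1ℤ
  wᴶ = 0ℤ , - (+ 2) , - (+ 4)

  open Series zᴶ wᴶ

  ·1ᴶ : ∀ m → m · 1ᴶ ≡ (+ m , 0ℤ , 0ℤ)
  ·1ᴶ zero    = refl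
  ·1ᴶ (suc m) = cong (1ᴶ +ᴶ_) (·1ᴶ m)

  zᴶ^ : ∀ m → zᴶ ^ m ≡ (1ℤ , + m , + m * + m)
  zᴶ^ zero    = refl
  zᴶ^ (suc m) = trans (cong (zᴶ *ᴶ_) (zᴶ^ m)) (triple refl (l₁ (+ m)) (l₂ (+ m)))
    where
    l₁ : ∀ m → 1ℤ * m + 1ℤ * 1ℤ ≡ 1ℤ + m
    l₁ = solve-∀
    l₂ : ∀ m → 1ℤ * (m * m) + + 2 * 1ℤ * m + 1ℤ * 1ℤ ≡ (1ℤ + m) * (1ℤ + m)
    l₂ = solve-∀

  wᴶ^3+ : ∀ d → wᴶ ^ (3 ℕ.+ d) ≡ 0ᴶ
  wᴶ^3+ zero    = refl
  wᴶ^3+ (suc d) = trans (cong (wᴶ *ᴶ_) (wᴶ^3+ d)) refl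

  -- As wᴶ ^ 3 = 0, only the last three terms of the sum contribute.
  moments : ∀ k →
    ∑ (λ t → zᴶ ^ oneSided 1 t) (treesOf (2 ℕ.+ k))
    ≡ 0ᴶ +ᴶ term (2 ℕ.+ k) k +ᴶ term (2 ℕ.+ k) (1 ℕ.+ k) +ᴶ term (2 ℕ.+ k) (2 ℕ.+ k)
  moments k = begin
    ∑ (λ t → zᴶ ^ oneSided 1 t) (treesOf (2 ℕ.+ k))
      -- The relation z² + w = 1 between these two jets holds by evaluation.
      ≡⟨ ∑-root≈∑-term refl k ⟩
    ∑ T (upTo (3 ℕ.+ k))
      ≡⟨ ∑-suc T id (2 ℕ.+ k) ⟩
    ∑ T (upTo (2 ℕ.+ k)) +ᴶ T (2 ℕ.+ k)
      ≡⟨ cong (_+ᴶ T (2 ℕ.+ k)) (∑-suc T id (1 ℕ.+ k)) ⟩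
    ∑ T (upTo (1 ℕ.+ k)) +ᴶ T (1 ℕ.+ k) +ᴶ T (2 ℕ.+ k)
      ≡⟨ cong (λ x → x +ᴶ T (1 ℕ.+ k) +ᴶ T (2 ℕ.+ k)) (∑-suc T id k) ⟩
    ∑ T (upTo k) +ᴶ T k +ᴶ T (1 ℕ.+ k) +ᴶ T (2 ℕ.+ k)
      ≡⟨ cong (λ x → x +ᴶ T k +ᴶ T (1 ℕ.+ k) +ᴶ T (2 ℕ.+ k)) (trans (∑-cong (upTo k) (λ j∈ → vanish (∈-upTo⁻ j∈))) (∑-zero (upTo k))) ⟩
    0ᴶ +ᴶ T k +ᴶ T (1 ℕ.+ k) +ᴶ T (2 ℕ.+ k) ∎
    where
    open ≡-Reasoning
    open import Data.List.Membership.Propositional.Properties using (∈-upTo⁻)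
    T : ℕ → Jet
    T = term (2 ℕ.+ k)
    ∑-zero : ∀ (xs : List ℕ) → ∑ (λ _ → 0ᴶ) xs ≡ 0ᴶ
    ∑-zero []       = refl
    ∑-zero (_ ∷ xs) = trans (cong (0ᴶ +ᴶ_) (∑-zero xs)) refl
    vanish : ∀ {j} → j ℕ.< k → T j ≡ 0ᴶ
    vanish {j} j<k = trans (cong (a *ᴶ_) (trans (cong (zᴶ ^ e *ᴶ_) w≡0) (zeroʳ (zᴶ ^ e)))) (zeroʳ a)
      where
      a = (catalan j ℕ.* numerator (j ℕ.+ 1) (2 ℕ.+ k ℕ.∸ j)) · 1ᴶ
      e = suc (j ℕ.+ 1) ℕ.∸ (2 ℕ.+ k ℕ.∸ j)
      i = k ℕ.∸ suc j
      k≡ : 2 ℕ.+ k ℕ.∸ j ≡ 3 ℕ.+ i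
      k≡ = trans (cong (λ x → 2 ℕ.+ x ℕ.∸ j) (sym (ℕ.m+[n∸m]≡n j<k)))
        (trans (cong (ℕ._∸ j) (l j i)) (ℕ.m+n∸m≡n j (3 ℕ.+ i)))
        where
        l : ∀ j i → 2 ℕ.+ (suc j ℕ.+ i) ≡ j ℕ.+ (3 ℕ.+ i)
        l = ℕ.solve-∀
      w≡0 : wᴶ ^ (2 ℕ.+ k ℕ.∸ j) ≡ 0ᴶ
      w≡0 = trans (cong (wᴶ ^_) k≡) (wᴶ^3+ i)

  -- Writing the index as d + j makes the exponent of `wᴶ` the numeral 0, 1 or 2 in the uses below,
  -- so that the power evaluates.
  term-jet : ∀ d j → term (d ℕ.+ j) j
    ≡ (+ catalan j * + numerator (j ℕ.+ 1) d , 0ℤ , 0ℤ)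
      *ᴶ ((1ℤ , + (suc (j ℕ.+ 1) ℕ.∸ d) , + (suc (j ℕ.+ 1) ℕ.∸ d) * + (suc (j ℕ.+ 1) ℕ.∸ d)) *ᴶ wᴶ ^ d)
  term-jet d j = trans (cong (λ i → (catalan j ℕ.* numerator (j ℕ.+ 1) i) · 1ᴶ *ᴶ (zᴶ ^ (suc (j ℕ.+ 1) ℕ.∸ i) *ᴶ wᴶ ^ i)) (ℕ.m+n∸n≡m d j))
    (cong₂ (λ x y → x *ᴶ (y *ᴶ wᴶ ^ d))
      (trans (·1ᴶ (catalan j ℕ.* numerator (j ℕ.+ 1) d)) (cong (λ x → x , 0ℤ , 0ℤ) (pos-* (catalan j) _)))
      (zᴶ^ (suc (j ℕ.+ 1) ℕ.∸ d)))

  term₀ : ∀ k → let c = + catalan (2 ℕ.+ k) ; n = + 4 + + k in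
    term (2 ℕ.+ k) (2 ℕ.+ k) ≡ (c , c * n , c * (n * n))
  term₀ k = trans (term-jet 0 (2 ℕ.+ k)) (trans
    (cong (λ e → (c * 1ℤ , 0ℤ , 0ℤ) *ᴶ ((1ℤ , e , e * e) *ᴶ 1ᴶ)) (cong (λ x → + (3 ℕ.+ x)) (ℕ.+-comm k 1)))
    (triple (l₀ c) (l₁ c (+ 4 + + k)) (l₂ c (+ 4 + + k))))
    where
    c = + catalan (2 ℕ.+ k)
    l₀ : ∀ c → c * 1ℤ * (1ℤ * 1ℤ) ≡ c
    l₀ = solve-∀
    l₁ : ∀ c n → c * 1ℤ * (1ℤ * 0ℤ + n * 1ℤ) + 0ℤ * (1ℤ * 1ℤ) ≡ c * n
    l₁ = solve-∀
    l₂ : ∀ c n → c * 1ℤ * (1ℤ * 0ℤ + + 2 * n * 0ℤ + n * n * 1ℤ) + + 2 * 0ℤ * (1ℤ * 0ℤ + n * 1ℤ) + 0ℤ * (1ℤ * 1ℤ) ≡ c * (n * n)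
    l₂ = solve-∀

  -- The summand is n C z^(n-2) w with C = `catalan (1 + k)`. In the second derivative the product
  -- rule adds 2 (n - 2) (-2) to the -4 from w, which makes -4 (n - 1).
  term₁ : ∀ k → let c = + catalan (1 ℕ.+ k) ; n = + 4 + + k in
    term (2 ℕ.+ k) (1 ℕ.+ k) ≡ (0ℤ , - (+ 2 * n * c) , - (+ 4 * n * (n - 1ℤ) * c))
  term₁ k = trans (term-jet 1 (1 ℕ.+ k)) (trans
    (cong₂ (λ N e → (c * N , 0ℤ , 0ℤ) *ᴶ ((1ℤ , e , e * e) *ᴶ (wᴶ *ᴶ 1ᴶ)))
      (cong +_ (trans (cong (ℕ._+ 2) (nC1≡n (suc (k ℕ.+ 1)))) (l k)))
      (cong (λ x → + (suc x)) (ℕ.+-comm k 1)))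
    (triple (l₀ c (+ 4 + + k)) (l₁ c (+ k)) (l₂ c (+ k))))
    where
    c = + catalan (1 ℕ.+ k)
    l : ∀ k → suc (k ℕ.+ 1) ℕ.+ 2 ≡ 4 ℕ.+ k
    l = ℕ.solve-∀
    l₀ : ∀ c n → c * n * (1ℤ * 0ℤ) ≡ 0ℤ
    l₀ = solve-∀
    l₁ : ∀ c k → c * (+ 4 + k) * (1ℤ * - (+ 2) + (+ 2 + k) * 0ℤ) + 0ℤ * (1ℤ * 0ℤ) ≡ - (+ 2 * (+ 4 + k) * c)
    l₁ = solve-∀
    l₂ : ∀ c k → c * (+ 4 + k) * (1ℤ * - (+ 4) + + 2 * (+ 2 + k) * - (+ 2) + (+ 2 + k) * (+ 2 + k) * 0ℤ)
        + + 2 * 0ℤ * (1ℤ * - (+ 2) + (+ 2 + k) * 0ℤ) + 0ℤ * (1ℤ * 0ℤ)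
      ≡ - (+ 4 * (+ 4 + k) * (+ 4 + k - 1ℤ) * c)
    l₂ = solve-∀

  -- The factor 8 is the second derivative of w² at x = 0. It also clears the fraction in the value
  -- (k + 1) (k + 4) / 2 of the numerator.
  8*numerator : ∀ k → 8 ℕ.* numerator (k ℕ.+ 1) 2 ≡ 4 ℕ.* (k ℕ.+ 1) ℕ.* (k ℕ.+ 4)
  8*numerator k = trans (cong (λ x → 8 ℕ.* numerator x 2) (ℕ.+-comm k 1)) (begin
    8 ℕ.* ((suc k C 2) ℕ.+ 2 ℕ.* (suc k C 1))
      ≡⟨ cong (λ x → 8 ℕ.* ((suc k C 2) ℕ.+ 2 ℕ.* x)) (nC1≡n (suc k)) ⟩
    8 ℕ.* ((suc k C 2) ℕ.+ 2 ℕ.* suc k)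
      ≡⟨ l₁ (suc k C 2) k ⟩
    4 ℕ.* (2 ℕ.* (suc k C 2)) ℕ.+ 16 ℕ.* suc k
      ≡⟨ cong (λ x → 4 ℕ.* x ℕ.+ 16 ℕ.* suc k) (trans (absorption k 1) (cong (suc k ℕ.*_) (nC1≡n k))) ⟩
    4 ℕ.* (suc k ℕ.* k) ℕ.+ 16 ℕ.* suc k
      ≡⟨ l₂ k ⟩
    4 ℕ.* (k ℕ.+ 1) ℕ.* (k ℕ.+ 4) ∎)
    where
    open ≡-Reasoning
    l₁ : ∀ x k → 8 ℕ.* (x ℕ.+ 2 ℕ.* suc k) ≡ 4 ℕ.* (2 ℕ.* x) ℕ.+ 16 ℕ.* suc k
    l₁ = ℕ.solve-∀
    l₂ : ∀ k → 4 ℕ.* (suc k ℕ.* k) ℕ.+ 16 ℕ.* suc k ≡ 4 ℕ.* (k ℕ.+ 1) ℕ.* (k ℕ.+ 4)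
    l₂ = ℕ.solve-∀

  -- The jet of w² is (0 , 0 , 8), so the power of z enters only through its value 1.
  term₂ : ∀ k → let c = + catalan k ; n = + 4 + + k in
    term (2 ℕ.+ k) k ≡ (0ℤ , 0ℤ , + 4 * n * (n - + 3) * c)
  term₂ k = trans (term-jet 2 k) (triple (l₀ c N) (l₁ c N e) (trans (l₂ c N e) (trans (cong (c *_) N≡) (l₃ c (+ k)))))
    where
    c = + catalan k
    N = + numerator (k ℕ.+ 1) 2
    e = + (suc (k ℕ.+ 1) ℕ.∸ 2)
    l₀ : ∀ c N → c * N * (1ℤ * 0ℤ) ≡ 0ℤ
    l₀ = solve-∀
    l₁ : ∀ c N e → c * N * (1ℤ * 0ℤ + e * 0ℤ) + 0ℤ * (1ℤ * 0ℤ) ≡ 0ℤ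
    l₁ = solve-∀
    l₂ : ∀ c N e → c * N * (1ℤ * + 8 + + 2 * e * 0ℤ + e * e * 0ℤ) + + 2 * 0ℤ * (1ℤ * 0ℤ + e * 0ℤ) + 0ℤ * (1ℤ * 0ℤ) ≡ c * (+ 8 * N)
    l₂ = solve-∀
    l₃ : ∀ c k → c * (+ 4 * (k + + 1) * (k + + 4)) ≡ + 4 * (+ 4 + k) * (+ 4 + k - + 3) * c
    l₃ = solve-∀
    N≡ : + 8 * N ≡ + 4 * (+ k + + 1) * (+ k + + 4)
    N≡ = trans (sym (pos-* 8 (numerator (k ℕ.+ 1) 2))) (trans (cong +_ (8*numerator k))
           (trans (pos-* (4 ℕ.* (k ℕ.+ 1)) (k ℕ.+ 4)) (cong (_* + (k ℕ.+ 4)) (pos-* 4 (k ℕ.+ 1)))))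

  sumℤ : {A : Set} → (A → ℤ) → List A → ℤ
  sumℤ f xs = foldr _+_ 0ℤ (map f xs)

  -- One identity between jets thus carries the count and both power sums.
  ∑-zᴶ^ : ∀ {A : Set} (s : A → ℕ) xs → ∑ (λ x → zᴶ ^ s x) xs
    ≡ (+ length xs , sumℤ (λ x → + s x) xs , sumℤ (λ x → + s x * + s x) xs)
  ∑-zᴶ^ s []       = refl
  ∑-zᴶ^ s (x ∷ xs) = cong₂ _+ᴶ_ (zᴶ^ (s x)) (∑-zᴶ^ s xs)

  module _ (k : ℕ) where

    private
      c₀ = + catalan k
      c₁ = + catalan (1 ℕ.+ k)
      c₂ = + catalan (2 ℕ.+ k)
      m₁ = sumℤ (λ t → + oneSided 1 t) (treesOf (2 ℕ.+ k))
      m₂ = sumℤ (λ t → + oneSided 1 t * + oneSided 1 t) (treesOf (2 ℕ.+ k))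
      n  = + 4 + + k

      catalan-ℤ : ∀ k → (+ 2 + + k) * + catalan (suc k) ≡ (+ 4 * + k + + 2) * + catalan k
      catalan-ℤ k = trans (sym (pos-* (2 ℕ.+ k) (catalan (suc k)))) (trans (cong +_ (catalan-suc k))
        (trans (pos-* (4 ℕ.* k ℕ.+ 2) (catalan k)) (cong (λ x → (x + + 2) * + catalan k) (pos-* 4 k))))

      all-moments : (+ length (treesOf (2 ℕ.+ k)) , m₁ , m₂)
        ≡ 0ᴶ +ᴶ (0ℤ , 0ℤ , + 4 * n * (n - + 3) * c₀) +ᴶ (0ℤ , - (+ 2 * n * c₁) , - (+ 4 * n * (n - 1ℤ) * c₁)) +ᴶ (c₂ , c₂ * n , c₂ * (n * n))
      all-moments = trans (sym (∑-zᴶ^ (oneSided 1) (treesOf (2 ℕ.+ k)))) (trans (moments k)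
        (cong₂ _+ᴶ_ (cong₂ (λ x y → 0ᴶ +ᴶ x +ᴶ y) (term₂ k) (term₁ k)) (term₀ k)))

      e₀ : (+ 2 + + k) * c₁ ≡ (+ 4 * + k + + 2) * c₀
      e₀ = catalan-ℤ k
      e₁ : (+ 3 + + k) * c₂ ≡ (+ 4 * (1ℤ + + k) + + 2) * c₁
      e₁ = catalan-ℤ (suc k)

    -- The value component corresponds to z = 1, where w = 0 and only `term₀` survives.
    length-trees : length (treesOf (2 ℕ.+ k)) ≡ catalan (2 ℕ.+ k)
    length-trees = +-injective (cong proj₁ all-moments)

    -- The jets give m₁ = n (c₂ - 2 c₁). The factor 2 k + 3 = 2 n - 5 is what `e₁` requires to
    -- express c₁ by c₂.
    first-moment : (+ 2 * + k + + 3) * m₁ ≡ (+ 4 + + k) * + k * c₂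
    first-moment = begin
      (+ 2 * + k + + 3) * m₁
        ≡⟨ cong ((+ 2 * + k + + 3) *_) (cong (proj₁ ∘ proj₂) all-moments) ⟩
      (+ 2 * + k + + 3) * (0ℤ + - (+ 2 * n * c₁) + c₂ * n)
        ≡⟨ l₁ (+ k) c₁ c₂ ⟩
      n * (+ 2 * + k + + 3) * c₂ - n * ((+ 4 * (1ℤ + + k) + + 2) * c₁)
        ≡⟨ cong (λ x → n * (+ 2 * + k + + 3) * c₂ - n * x) (sym e₁) ⟩
      n * (+ 2 * + k + + 3) * c₂ - n * ((+ 3 + + k) * c₂)
        ≡⟨ l₂ (+ k) c₂ ⟩
      n * + k * c₂ ∎
      where
      open ≡-Reasoning
      l₁ : ∀ k c₁ c₂ → (+ 2 * k + + 3) * (0ℤ + - (+ 2 * (+ 4 + k) * c₁) + c₂ * (+ 4 + k))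
         ≡ (+ 4 + k) * (+ 2 * k + + 3) * c₂ - (+ 4 + k) * ((+ 4 * (1ℤ + k) + + 2) * c₁)
      l₁ = solve-∀
      l₂ : ∀ k c₂ → (+ 4 + k) * (+ 2 * k + + 3) * c₂ - (+ 4 + k) * ((+ 3 + k) * c₂) ≡ (+ 4 + k) * k * c₂
      l₂ = solve-∀

    -- One factor 2 k + 3 and the factor 2 k + 1 = 2 n - 7 eliminate c₁ and c₀. The second factor 2
    -- k + 3 allows the right side to be split into the numerator of the variance and the
    -- contribution of the squared mean.
    second-moment : (+ 2 * + k + + 3) * (+ 2 * + k + + 3) * (+ 2 * + k + + 1) * m₂
      ≡ (+ 2 * (+ 4 + + k) * (+ 3 + + k) * + k * (+ k - 1ℤ)
         + (+ 4 + + k) * + k * ((+ 4 + + k) * + k) * (+ 2 * + k + + 1)) * c₂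
    second-moment = begin
      b * b * c * m₂
        ≡⟨ cong (b * b * c *_) (cong (proj₂ ∘ proj₂) all-moments) ⟩
      b * b * c * (0ℤ + + 4 * n * (n - + 3) * c₀ + - (+ 4 * n * (n - 1ℤ) * c₁) + c₂ * (n * n))
        ≡⟨ l₁ (+ k) c₀ c₁ c₂ ⟩
      b * (b * c * (n * n) * c₂ - + 2 * n * (+ 3 + + k) * c * ((+ 4 * (1ℤ + + k) + + 2) * c₁)
           + (1ℤ + + k) * n * (+ 2 * b * ((+ 4 * + k + + 2) * c₀)))
        ≡⟨ cong (λ x → b * (b * c * (n * n) * c₂ - + 2 * n * (+ 3 + + k) * c * ((+ 4 * (1ℤ + + k) + + 2) * c₁) + (1ℤ + + k) * n * (+ 2 * b * x))) (sym e₀) ⟩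
      b * (b * c * (n * n) * c₂ - + 2 * n * (+ 3 + + k) * c * ((+ 4 * (1ℤ + + k) + + 2) * c₁)
           + (1ℤ + + k) * n * (+ 2 * b * ((+ 2 + + k) * c₁)))
        ≡⟨ l₂ (+ k) c₁ c₂ ⟩
      b * (b * c * (n * n) * c₂ + ((1ℤ + + k) * n * (+ 2 + + k) - + 2 * n * (+ 3 + + k) * c) * ((+ 4 * (1ℤ + + k) + + 2) * c₁))
        ≡⟨ cong (λ x → b * (b * c * (n * n) * c₂ + ((1ℤ + + k) * n * (+ 2 + + k) - + 2 * n * (+ 3 + + k) * c) * x)) (sym e₁) ⟩
      b * (b * c * (n * n) * c₂ + ((1ℤ + + k) * n * (+ 2 + + k) - + 2 * n * (+ 3 + + k) * c) * ((+ 3 + + k) * c₂))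
        ≡⟨ l₃ (+ k) c₂ ⟩
      (+ 2 * (+ 4 + + k) * (+ 3 + + k) * + k * (+ k - 1ℤ) + (+ 4 + + k) * + k * ((+ 4 + + k) * + k) * c) * c₂ ∎
      where
      open ≡-Reasoning
      b = + 2 * + k + + 3
      c = + 2 * + k + + 1
      l₁ : ∀ k c₀ c₁ c₂ → (+ 2 * k + + 3) * (+ 2 * k + + 3) * (+ 2 * k + + 1)
           * (0ℤ + + 4 * (+ 4 + k) * (+ 4 + k - + 3) * c₀ + - (+ 4 * (+ 4 + k) * (+ 4 + k - 1ℤ) * c₁) + c₂ * ((+ 4 + k) * (+ 4 + k)))
         ≡ (+ 2 * k + + 3) * ((+ 2 * k + + 3) * (+ 2 * k + + 1) * ((+ 4 + k) * (+ 4 + k)) * c₂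
           - + 2 * (+ 4 + k) * (+ 3 + k) * (+ 2 * k + + 1) * ((+ 4 * (1ℤ + k) + + 2) * c₁)
           + (1ℤ + k) * (+ 4 + k) * (+ 2 * (+ 2 * k + + 3) * ((+ 4 * k + + 2) * c₀)))
      l₁ = solve-∀
      l₂ : ∀ k c₁ c₂ → (+ 2 * k + + 3) * ((+ 2 * k + + 3) * (+ 2 * k + + 1) * ((+ 4 + k) * (+ 4 + k)) * c₂
           - + 2 * (+ 4 + k) * (+ 3 + k) * (+ 2 * k + + 1) * ((+ 4 * (1ℤ + k) + + 2) * c₁)
           + (1ℤ + k) * (+ 4 + k) * (+ 2 * (+ 2 * k + + 3) * ((+ 2 + k) * c₁)))
         ≡ (+ 2 * k + + 3) * ((+ 2 * k + + 3) * (+ 2 * k + + 1) * ((+ 4 + k) * (+ 4 + k)) * c₂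
           + ((1ℤ + k) * (+ 4 + k) * (+ 2 + k) - + 2 * (+ 4 + k) * (+ 3 + k) * (+ 2 * k + + 1)) * ((+ 4 * (1ℤ + k) + + 2) * c₁))
      l₂ = solve-∀
      l₃ : ∀ k c₂ → (+ 2 * k + + 3) * ((+ 2 * k + + 3) * (+ 2 * k + + 1) * ((+ 4 + k) * (+ 4 + k)) * c₂
           + ((1ℤ + k) * (+ 4 + k) * (+ 2 + k) - + 2 * (+ 4 + k) * (+ 3 + k) * (+ 2 * k + + 1)) * ((+ 3 + k) * c₂))
         ≡ (+ 2 * (+ 4 + k) * (+ 3 + k) * k * (k - 1ℤ) + (+ 4 + k) * k * ((+ 4 + k) * k) * (+ 2 * k + + 1)) * c₂
      l₃ = solve-∀

-- From sums over trees to expectations over triangulations.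

module Expectations where

  open CatalanNumbers using (catalan-suc)
  open Dissections
  open GeneratingFunctions
  open Moments
  open import Algebra.Bundles using (CommutativeSemiring; CommutativeRing)
  open import Algebra.Morphism.Structures using (module RingMorphisms)
  open import Data.Empty using (⊥-elim)
  open import Data.Integer.Base as ℤ using (ℤ; +_)
  import Data.Integer.Properties as ℤ
  import Data.Integer.Tactic.RingSolver as ℤ
  open import Data.List.Base using (List; []; _∷_; length; upTo; foldr; map)
  open import Data.List.Properties using (length-map)
  open import Data.List.Membership.Propositional.Properties using (∈-upTo⁻)
  open import Data.List.Relation.Binary.Permutation.Propositional.Properties using (↭-length)
  open import Data.Nat.Base as ℕ using (ℕ; zero; suc; _*_; _∸_; _^_; _≥_; z≤n; s≤s)
  import Data.Nat.Properties as ℕ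
  import Data.Nat.Tactic.RingSolver as ℕ
  open import Data.Nat.Combinatorics using (_C_)
  open import Data.Product.Base using (_×_; _,_)
  open import Data.Sum.Base using (inj₁; inj₂)
  open import Data.Rational.Base as ℚ using (ℚ; 0ℚ; 1ℚ; fromℚᵘ; toℚᵘ)
  import Data.Rational.Properties as ℚ
  open import Data.Rational.Unnormalised.Base as ℚᵘ using (ℚᵘ; mkℚᵘ; *≡*)
  import Data.Rational.Unnormalised.Properties as ℚᵘ
  open import Data.Rational.Solver using (module +-*-Solver)
  open import Function.Base using (_∘_)
  open import Level using (Level)
  open import Relation.Binary.PropositionalEquality hiding (setoid)

  module _ {c ℓ} (R : CommutativeSemiring c ℓ) where
    open CommutativeSemiring R using (_≈_; Carrier; reflexive) renaming (trans to ≈-trans; sym to ≈-sym)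
    open Algebraic R using (∑; ∑-↭; ∑-map; ∑-cong)

    -- Stated for arbitrary `f`, it transfers the powers z ^ s in the algebra as well as s and s² in
    -- the integers.
    ∑-triangulations : ∀ {n} → n ≥ 4 → (f : ℕ → Carrier) →
      ∑ (f ∘ S n) (triangulations n) ≈ ∑ (f ∘ oneSided 1) (treesOf (n ∸ 2))
    ∑-triangulations {n} n≥4 f = ≈-trans (∑-↭ (f ∘ S n) (triangulations↭trees n≥4))
      (≈-trans (reflexive (∑-map (f ∘ S n) (diagonalsOf n) (treesOf (n ∸ 2))))
        (∑-cong (treesOf (n ∸ 2)) λ {t} t∈ → reflexive (cong f (S≡oneSided {n} {t} n≥4 (∈treesOf⇒end n≥4 t∈)))))

  length-triangulations : ∀ {n} → n ≥ 4 → length (triangulations n) ≡ catalan (n ∸ 2)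
  length-triangulations {n} n≥4@(s≤s (s≤s (s≤s (s≤s {n = k} z≤n)))) =
    trans (↭-length (triangulations↭trees n≥4)) (trans (length-map (diagonalsOf n) (treesOf (n ∸ 2))) (length-trees k))

  catalan≢0 : ∀ k → catalan k ≢ 0
  -- For k = 0 the equation evaluates to 1 ≡ 0 and is absurd; otherwise the ratio recurrence passes
  -- a zero down from k + 1 to k.
  catalan≢0 (suc k) eq = catalan≢0 k (ℕ.m*n≡0⇒m≡0 (catalan k) (4 * k ℕ.+ 2)
    {{ℕ.>-nonZero (ℕ.≤-trans (s≤s z≤n) (ℕ.m≤n+m 2 (4 * k)))}}
    (trans (ℕ.*-comm (catalan k) _) (trans (sym (catalan-suc k)) (trans (cong ((2 ℕ.+ k) *_) eq) (ℕ.*-zeroʳ (2 ℕ.+ k))))))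

  fromℚᵘ-homo-+ : ∀ x y → fromℚᵘ (x ℚᵘ.+ y) ≡ fromℚᵘ x ℚ.+ fromℚᵘ y
  fromℚᵘ-homo-+ x y = ℚ.toℚᵘ-injective (begin
    toℚᵘ (fromℚᵘ (x ℚᵘ.+ y))                    ≈⟨ ℚ.toℚᵘ-fromℚᵘ (x ℚᵘ.+ y) ⟩
    x ℚᵘ.+ y                                    ≈⟨ ℚᵘ.+-cong (ℚ.toℚᵘ-fromℚᵘ x) (ℚ.toℚᵘ-fromℚᵘ y) ⟨
    toℚᵘ (fromℚᵘ x) ℚᵘ.+ toℚᵘ (fromℚᵘ y)        ≈⟨ ℚ.toℚᵘ-homo-+ (fromℚᵘ x) (fromℚᵘ y) ⟨
    toℚᵘ (fromℚᵘ x ℚ.+ fromℚᵘ y)                ∎)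
    where open ℚᵘ.≃-Reasoning

  fromℚᵘ-homo-* : ∀ x y → fromℚᵘ (x ℚᵘ.* y) ≡ fromℚᵘ x ℚ.* fromℚᵘ y
  fromℚᵘ-homo-* x y = ℚ.toℚᵘ-injective (begin
    toℚᵘ (fromℚᵘ (x ℚᵘ.* y))                    ≈⟨ ℚ.toℚᵘ-fromℚᵘ (x ℚᵘ.* y) ⟩
    x ℚᵘ.* y                                    ≈⟨ ℚᵘ.*-cong (ℚ.toℚᵘ-fromℚᵘ x) (ℚ.toℚᵘ-fromℚᵘ y) ⟨
    toℚᵘ (fromℚᵘ x) ℚᵘ.* toℚᵘ (fromℚᵘ y)        ≈⟨ ℚ.toℚᵘ-homo-* (fromℚᵘ x) (fromℚᵘ y) ⟨
    toℚᵘ (fromℚᵘ x ℚ.* fromℚᵘ y)                ∎)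
    where open ℚᵘ.≃-Reasoning

  fromℤ-homo-+ : ∀ a b → fromℤ (a ℤ.+ b) ≡ fromℤ a ℚ.+ fromℤ b
  fromℤ-homo-+ a b = trans
    (ℚ.fromℚᵘ-cong {mkℚᵘ (a ℤ.+ b) 0} {mkℚᵘ a 0 ℚᵘ.+ mkℚᵘ b 0} (*≡* (l a b)))
    (fromℚᵘ-homo-+ (mkℚᵘ a 0) (mkℚᵘ b 0))
    where
    l : ∀ a b → (a ℤ.+ b) ℤ.* + 1 ≡ (a ℤ.* + 1 ℤ.+ b ℤ.* + 1) ℤ.* + 1
    l = ℤ.solve-∀

  fromℤ-homo-* : ∀ a b → fromℤ (a ℤ.* b) ≡ fromℤ a ℚ.* fromℤ b
  fromℤ-homo-* a b = fromℚᵘ-homo-* (mkℚᵘ a 0) (mkℚᵘ b 0)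

  1/₀-inverse : ∀ m → m ≢ 0 → fromℤ (+ m) ℚ.* (+ 1 /₀ m) ≡ 1ℚ
  1/₀-inverse zero    m≢0 = ⊥-elim (m≢0 refl)
  1/₀-inverse (suc q) _   = trans (sym (fromℚᵘ-homo-* (mkℚᵘ (+ suc q) 0) (mkℚᵘ (+ 1) q)))
    (ℚ.fromℚᵘ-cong {mkℚᵘ (+ suc q) 0 ℚᵘ.* mkℚᵘ (+ 1) q} {mkℚᵘ (+ 1) 0} (*≡* (cong +_ (l q))))
    where
    l : ∀ q → suc q * 1 * 1 ≡ 1 * (1 * suc q)
    l = ℕ.solve-∀

  /₀≡*1/₀ : ∀ p m → p /₀ m ≡ fromℤ p ℚ.* (+ 1 /₀ m)
  /₀≡*1/₀ p zero    = sym (ℚ.*-zeroʳ (fromℤ p))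
  /₀≡*1/₀ p (suc q) = trans
    (ℚ.fromℚᵘ-cong {mkℚᵘ p q} {mkℚᵘ p 0 ℚᵘ.* mkℚᵘ (+ 1) q} (*≡* (cong₂ ℤ._*_ (sym (ℤ.*-identityʳ p)) (cong +_ (ℕ.*-identityˡ (suc q))))))
    (fromℚᵘ-homo-* (mkℚᵘ p 0) (mkℚᵘ (+ 1) q))

  -- Reduces the closed forms (II) and (III) to equations without division.
  /₀-unique : ∀ x p m → m ≢ 0 → fromℤ (+ m) ℚ.* x ≡ fromℤ p → x ≡ p /₀ m
  /₀-unique x p m m≢0 eq = begin
    x                                            ≡⟨ ℚ.*-identityˡ x ⟨
    1ℚ ℚ.* x                                     ≡⟨ cong (ℚ._* x) (1/₀-inverse m m≢0) ⟨
    fromℤ (+ m) ℚ.* (+ 1 /₀ m) ℚ.* x             ≡⟨ l (fromℤ (+ m)) (+ 1 /₀ m) x ⟩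
    fromℤ (+ m) ℚ.* x ℚ.* (+ 1 /₀ m)             ≡⟨ cong (ℚ._* (+ 1 /₀ m)) eq ⟩
    fromℤ p ℚ.* (+ 1 /₀ m)                       ≡⟨ /₀≡*1/₀ p m ⟨
    p /₀ m                                       ∎
    where
    open ≡-Reasoning
    l : ∀ a b c → a ℚ.* b ℚ.* c ≡ a ℚ.* c ℚ.* b
    l = solve 3 (λ a b c → a :* b :* c := a :* c :* b) refl
      where open +-*-Solver

  coefficient≡ : ∀ k j → coefficient (4 ℕ.+ k) j ≡ + (catalan j * numerator (j ℕ.+ 1) (2 ℕ.+ k ∸ j))
  coefficient≡ k j = begin
    + catalan j ℤ.* (+ 2 ℤ.* + ((j ℕ.+ 2) C d) ℤ.- + ((j ℕ.+ 1) C d))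
      ≡⟨ cong (λ i → + catalan j ℤ.* (+ 2 ℤ.* + (i C d) ℤ.- + ((j ℕ.+ 1) C d))) (ℕ.+-suc j 1) ⟩
    + catalan j ℤ.* (+ 2 ℤ.* + (suc (j ℕ.+ 1) C d) ℤ.- + ((j ℕ.+ 1) C d))
      ≡⟨ cong (λ x → + catalan j ℤ.* (x ℤ.- + ((j ℕ.+ 1) C d)))
           (trans (sym (ℤ.pos-* 2 (suc (j ℕ.+ 1) C d))) (cong +_ (sym (numerator≡ (j ℕ.+ 1) d)))) ⟩
    + catalan j ℤ.* (+ numerator (j ℕ.+ 1) d ℤ.+ + ((j ℕ.+ 1) C d) ℤ.- + ((j ℕ.+ 1) C d))
      ≡⟨ l (+ catalan j) (+ numerator (j ℕ.+ 1) d) (+ ((j ℕ.+ 1) C d)) ⟩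
    + catalan j ℤ.* + numerator (j ℕ.+ 1) d
      ≡⟨ ℤ.pos-* (catalan j) _ ⟨
    + (catalan j * numerator (j ℕ.+ 1) d) ∎
    where
    open ≡-Reasoning
    d = 2 ℕ.+ k ∸ j
    l : ∀ c x y → c ℤ.* (x ℤ.+ y ℤ.- y) ≡ c ℤ.* x
    l = ℤ.solve-∀

  -- Both truncated differences arise by cancelling the common summand 2 + j, so they agree even
  -- where they truncate to 0.
  exponent≡ : ∀ k j → j ℕ.≤ 2 ℕ.+ k → 2 * j ℕ.+ 4 ∸ (4 ℕ.+ k) ≡ suc (j ℕ.+ 1) ∸ (2 ℕ.+ k ∸ j)
  exponent≡ k j j≤ = begin
    2 * j ℕ.+ 4 ∸ (2 ℕ.+ (2 ℕ.+ k))
      ≡⟨ cong₂ _∸_ (l₁ j) (cong (2 ℕ.+_) (sym (ℕ.m+[n∸m]≡n j≤))) ⟩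
    2 ℕ.+ j ℕ.+ suc (j ℕ.+ 1) ∸ (2 ℕ.+ j ℕ.+ (2 ℕ.+ k ∸ j))
      ≡⟨ ℕ.[m+n]∸[m+o]≡n∸o (2 ℕ.+ j) (suc (j ℕ.+ 1)) (2 ℕ.+ k ∸ j) ⟩
    suc (j ℕ.+ 1) ∸ (2 ℕ.+ k ∸ j) ∎
    where
    open ≡-Reasoning
    l₁ : ∀ j → 2 * j ℕ.+ 4 ≡ 2 ℕ.+ j ℕ.+ suc (j ℕ.+ 1)
    l₁ = ℕ.solve-∀

  module _ {c ℓ} (A : ℚ-Algebra c ℓ) where
    open ℚ-Algebra A
    open CommutativeRing commutativeRing
      using ( commutativeSemiring; setoid; reflexive; -_; +-cong; +-congˡ; +-congʳ; +-assoc; +-comm; +-identityʳ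
            ; -‿inverseˡ; *-cong; *-congˡ; *-congʳ; *-assoc; *-identityʳ)
      renaming (sym to ≈-sym; trans to ≈-trans)
    open RingMorphisms.IsRingHomomorphism ι-isRingHomomorphism using (+-homo; 0#-homo; 1#-homo)
    open import Algebra.Properties.Semiring.Mult semiring using () renaming (_×_ to _·_)
    open Algebraic commutativeSemiring using (∑; ∑-cong; module Series)
    open import Relation.Binary.Reasoning.Setoid setoid

    ι-fromℤ : ∀ m → ι (fromℤ (+ m)) ≈ m · 1#
    ι-fromℤ zero    = 0#-homo
    ι-fromℤ (suc m) = begin
      ι (fromℤ (+ suc m))                  ≡⟨ cong ι (fromℤ-homo-+ (+ 1) (+ m)) ⟩
      ι (1ℚ ℚ.+ fromℤ (+ m))               ≈⟨ +-homo 1ℚ (fromℤ (+ m)) ⟩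
      ι 1ℚ +ᴬ ι (fromℤ (+ m))              ≈⟨ +-cong 1#-homo (ι-fromℤ m) ⟩
      1# +ᴬ m · 1#                         ∎

    g≈gFormula : ∀ n → n ≥ 4 → ∀ z → g A n z ≈ gFormula A n z
    g≈gFormula n n≥4@(s≤s (s≤s (s≤s (s≤s {n = k} z≤n)))) z = begin
      ι ((+ 1) /₀ length (triangulations n)) *ᴬ ∑ (λ T → z ^ᴬ S n T) (triangulations n)
        ≈⟨ *-cong (reflexive (cong (λ m → ι ((+ 1) /₀ m)) (length-triangulations n≥4)))
                  (∑-triangulations commutativeSemiring n≥4 (z ^ᴬ_)) ⟩
      ι ((+ 1) /₀ catalan (2 ℕ.+ k)) *ᴬ ∑ (λ t → z ^ᴬ oneSided 1 t) (treesOf (2 ℕ.+ k))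
        ≈⟨ *-congˡ (∑-root≈∑-term z²+w≈1 k) ⟩
      ι ((+ 1) /₀ catalan (2 ℕ.+ k)) *ᴬ ∑ (term (2 ℕ.+ k)) (upTo (3 ℕ.+ k))
        ≈⟨ *-congˡ (∑-cong (upTo (3 ℕ.+ k)) λ j∈ → ≈-sym (termwise _ (∈-upTo⁻ j∈))) ⟩
      gFormula A n z ∎
      where
      open Series z (1# -ᴬ z ^ᴬ 2)
      z²+w≈1 : z *ᴬ z +ᴬ (1# -ᴬ z ^ᴬ 2) ≈ 1#
      z²+w≈1 = begin
        z *ᴬ z +ᴬ (1# -ᴬ z ^ᴬ 2)        ≈⟨ +-congʳ (*-congˡ (≈-sym (*-identityʳ z))) ⟩
        z ^ᴬ 2 +ᴬ (1# -ᴬ z ^ᴬ 2)        ≈⟨ +-comm _ _ ⟩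
        1# -ᴬ z ^ᴬ 2 +ᴬ z ^ᴬ 2          ≈⟨ +-assoc _ _ _ ⟩
        1# +ᴬ (- (z ^ᴬ 2) +ᴬ z ^ᴬ 2)    ≈⟨ +-congˡ (-‿inverseˡ _) ⟩
        1# +ᴬ 0#                        ≈⟨ +-identityʳ 1# ⟩
        1#                              ∎
      termwise : ∀ j → j ℕ.< 3 ℕ.+ k →
        ι (fromℤ (coefficient n j)) *ᴬ z ^ᴬ (2 * j ℕ.+ 4 ∸ n) *ᴬ (1# -ᴬ z ^ᴬ 2) ^ᴬ (2 ℕ.+ k ∸ j) ≈ term (2 ℕ.+ k) j
      termwise j (s≤s j≤) = ≈-trans (*-assoc _ _ _) (*-cong
        (≈-trans (reflexive (cong (ι ∘ fromℤ) (coefficient≡ k j))) (ι-fromℤ (catalan j * numerator (j ℕ.+ 1) (2 ℕ.+ k ∸ j))))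
        (*-congʳ (reflexive (cong (z ^ᴬ_) (exponent≡ k j j≤)))))

  ℤ-commutativeSemiring ℚ-commutativeSemiring : CommutativeSemiring _ _
  ℤ-commutativeSemiring = CommutativeRing.commutativeSemiring ℤ.+-*-commutativeRing
  ℚ-commutativeSemiring = CommutativeRing.commutativeSemiring ℚ.+-*-commutativeRing

  sumℚ : {A : Set} → (A → ℚ) → List A → ℚ
  sumℚ f xs = foldr ℚ._+_ 0ℚ (map f xs)

  sumℚ-fromℤ : ∀ {A : Set} (f : A → ℤ) xs → sumℚ (fromℤ ∘ f) xs ≡ fromℤ (sumℤ f xs)
  sumℚ-fromℤ f []       = refl
  sumℚ-fromℤ f (x ∷ xs) = trans (cong (fromℤ (f x) ℚ.+_) (sumℚ-fromℤ f xs)) (sym (fromℤ-homo-+ (f x) (sumℤ f xs)))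

  -- The centre μ is arbitrary: the mean depends on the whole list and would not be preserved by the
  -- induction.
  sumℚ-square : ∀ {A : Set} (s : A → ℕ) μ xs →
    sumℚ (λ x → (fromℤ (+ s x) ℚ.- μ) ℚ.* (fromℤ (+ s x) ℚ.- μ)) xs
    ≡ fromℤ (sumℤ (λ x → + s x ℤ.* + s x) xs) ℚ.- (μ ℚ.+ μ) ℚ.* fromℤ (sumℤ (λ x → + s x) xs) ℚ.+ μ ℚ.* μ ℚ.* fromℤ (+ length xs)
  sumℚ-square s μ [] = solve 1 (λ μ → con 0ℚ := con 0ℚ :- (μ :+ μ) :* con 0ℚ :+ μ :* μ :* con 0ℚ) refl μ
    where open +-*-Solver
  sumℚ-square s μ (x ∷ xs) = begin
    (y ℚ.- μ) ℚ.* (y ℚ.- μ) ℚ.+ sumℚ (λ x → (fromℤ (+ s x) ℚ.- μ) ℚ.* (fromℤ (+ s x) ℚ.- μ)) xs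
      ≡⟨ cong ((y ℚ.- μ) ℚ.* (y ℚ.- μ) ℚ.+_) (sumℚ-square s μ xs) ⟩
    (y ℚ.- μ) ℚ.* (y ℚ.- μ) ℚ.+ (fromℤ Q ℚ.- (μ ℚ.+ μ) ℚ.* fromℤ P ℚ.+ μ ℚ.* μ ℚ.* fromℤ L)
      ≡⟨ l y μ (fromℤ Q) (fromℤ P) (fromℤ L) ⟩
    y ℚ.* y ℚ.+ fromℤ Q ℚ.- (μ ℚ.+ μ) ℚ.* (y ℚ.+ fromℤ P) ℚ.+ μ ℚ.* μ ℚ.* (1ℚ ℚ.+ fromℤ L)
      ≡⟨ cong₂ (λ u v → u ℚ.- (μ ℚ.+ μ) ℚ.* v ℚ.+ μ ℚ.* μ ℚ.* (1ℚ ℚ.+ fromℤ L))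
           (sym (trans (fromℤ-homo-+ (+ s x ℤ.* + s x) Q) (cong (ℚ._+ fromℤ Q) (fromℤ-homo-* (+ s x) (+ s x))))) (sym (fromℤ-homo-+ (+ s x) P)) ⟩
    fromℤ (+ s x ℤ.* + s x ℤ.+ Q) ℚ.- (μ ℚ.+ μ) ℚ.* fromℤ (+ s x ℤ.+ P) ℚ.+ μ ℚ.* μ ℚ.* (1ℚ ℚ.+ fromℤ L)
      ≡⟨ cong (λ u → fromℤ (+ s x ℤ.* + s x ℤ.+ Q) ℚ.- (μ ℚ.+ μ) ℚ.* fromℤ (+ s x ℤ.+ P) ℚ.+ μ ℚ.* μ ℚ.* u) (fromℤ-homo-+ (+ 1) L) ⟨
    fromℤ (+ s x ℤ.* + s x ℤ.+ Q) ℚ.- (μ ℚ.+ μ) ℚ.* fromℤ (+ s x ℤ.+ P) ℚ.+ μ ℚ.* μ ℚ.* fromℤ (+ 1 ℤ.+ L) ∎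
    where
    open ≡-Reasoning
    y = fromℤ (+ s x)
    P = sumℤ (λ x → + s x) xs
    Q = sumℤ (λ x → + s x ℤ.* + s x) xs
    L = + length xs
    l : ∀ y μ Q P L → (y ℚ.- μ) ℚ.* (y ℚ.- μ) ℚ.+ (Q ℚ.- (μ ℚ.+ μ) ℚ.* P ℚ.+ μ ℚ.* μ ℚ.* L)
      ≡ y ℚ.* y ℚ.+ Q ℚ.- (μ ℚ.+ μ) ℚ.* (y ℚ.+ P) ℚ.+ μ ℚ.* μ ℚ.* (1ℚ ℚ.+ L)
    l = solve 5 (λ y μ Q P L → (y :- μ) :* (y :- μ) :+ (Q :- (μ :+ μ) :* P :+ μ :* μ :* L)
      := y :* y :+ Q :- (μ :+ μ) :* (y :+ P) :+ μ :* μ :* (con 1ℚ :+ L)) refl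
      where open +-*-Solver

  -- Mean and variance for n = 4 + k.

  module _ (k : ℕ) where

    n : ℕ
    n = 4 ℕ.+ k

    n≥4 : n ≥ 4
    n≥4 = s≤s (s≤s (s≤s (s≤s z≤n)))

    N : ℕ
    N = catalan (2 ℕ.+ k)

    N≢0 : N ≢ 0
    N≢0 = catalan≢0 (2 ℕ.+ k)

    N⁻¹ : ℚ
    N⁻¹ = + 1 /₀ N

    N*N⁻¹ : fromℤ (+ N) ℚ.* N⁻¹ ≡ 1ℚ
    N*N⁻¹ = 1/₀-inverse N N≢0

    M₁ M₂ : ℤ
    M₁ = sumℤ (λ T → + S n T) (triangulations n)
    M₂ = sumℤ (λ T → + S n T ℤ.* + S n T) (triangulations n)

    mean≡M₁/N : mean n ≡ N⁻¹ ℚ.* fromℤ M₁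
    mean≡M₁/N = cong₂ (λ x y → (+ 1 /₀ x) ℚ.* y) (length-triangulations n≥4) (sumℚ-fromℤ (λ T → + S n T) (triangulations n))

    b d : ℕ
    b = 2 * n ∸ 5
    d = 2 * n ∸ 7

    b≡ : b ≡ 2 * k ℕ.+ 3
    b≡ = trans (cong (_∸ 5) (l k)) (ℕ.m+n∸m≡n 5 (2 * k ℕ.+ 3))
      where
      l : ∀ k → 2 * (4 ℕ.+ k) ≡ 5 ℕ.+ (2 * k ℕ.+ 3)
      l = ℕ.solve-∀

    d≡ : d ≡ 2 * k ℕ.+ 1
    d≡ = trans (cong (_∸ 7) (l k)) (ℕ.m+n∸m≡n 7 (2 * k ℕ.+ 1))
      where
      l : ∀ k → 2 * (4 ℕ.+ k) ≡ 7 ℕ.+ (2 * k ℕ.+ 1)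
      l = ℕ.solve-∀

    +b≡ : + b ≡ + 2 ℤ.* + k ℤ.+ + 3
    +b≡ = trans (cong +_ b≡) (cong (ℤ._+ + 3) (ℤ.pos-* 2 k))

    +d≡ : + d ≡ + 2 ℤ.* + k ℤ.+ + 1
    +d≡ = trans (cong +_ d≡) (cong (ℤ._+ + 1) (ℤ.pos-* 2 k))

    a : ℕ
    a = n * k

    b*M₁ : + b ℤ.* M₁ ≡ + a ℤ.* + N
    b*M₁ = trans (cong₂ ℤ._*_ +b≡ (∑-triangulations ℤ-commutativeSemiring n≥4 +_))
      (trans (first-moment k) (cong (ℤ._* + N) (sym (ℤ.pos-* n k))))

    b*mean : fromℤ (+ b) ℚ.* mean n ≡ fromℤ (+ a)
    b*mean = begin
      fromℤ (+ b) ℚ.* mean n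
        ≡⟨ cong (fromℤ (+ b) ℚ.*_) mean≡M₁/N ⟩
      fromℤ (+ b) ℚ.* (N⁻¹ ℚ.* fromℤ M₁)
        ≡⟨ l (fromℤ (+ b)) N⁻¹ (fromℤ M₁) ⟩
      fromℤ (+ b) ℚ.* fromℤ M₁ ℚ.* N⁻¹
        ≡⟨ cong (ℚ._* N⁻¹) (trans (sym (fromℤ-homo-* (+ b) M₁)) (trans (cong fromℤ b*M₁) (fromℤ-homo-* (+ a) (+ N)))) ⟩
      fromℤ (+ a) ℚ.* fromℤ (+ N) ℚ.* N⁻¹
        ≡⟨ trans (ℚ.*-assoc (fromℤ (+ a)) _ _) (cong (fromℤ (+ a) ℚ.*_) N*N⁻¹) ⟩
      fromℤ (+ a) ℚ.* 1ℚ
        ≡⟨ ℚ.*-identityʳ _ ⟩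
      fromℤ (+ a) ∎
      where
      open ≡-Reasoning
      l : ∀ x y z → x ℚ.* (y ℚ.* z) ≡ x ℚ.* z ℚ.* y
      l = solve 3 (λ x y z → x :* (y :* z) := x :* z :* y) refl
        where open +-*-Solver

    b≢0 : b ≢ 0
    b≢0 b≡0 = ℕ.m+1+n≢0 (2 * k) (trans (sym b≡) b≡0)

    d≢0 : d ≢ 0
    d≢0 d≡0 = ℕ.m+1+n≢0 (2 * k) (trans (sym d≡) d≡0)

    mean≡ : mean n ≡ (+ a) /₀ b
    mean≡ = /₀-unique (mean n) (+ a) b b≢0 b*mean

    -- Denominator and numerator of (III). With n = 4 + k the differences n ∸ 4 and n ∸ 5 evaluate
    -- to `k` and `k ∸ 1`.
    D e : ℕ
    D = b ^ 2 * d
    e = 2 * n * (n ∸ 1) * k * (k ∸ 1)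

    D≢0 : D ≢ 0
    D≢0 D≡0 with ℕ.m*n≡0⇒m≡0∨n≡0 (b ^ 2) D≡0
    ... | inj₁ b²≡0 = b≢0 (ℕ.m^n≡0⇒m≡0 b 2 b²≡0)
    ... | inj₂ d≡0  = d≢0 d≡0

    D*M₂ : k ≥ 1 → + D ℤ.* M₂ ≡ (+ e ℤ.+ + a ℤ.* + a ℤ.* + d) ℤ.* + N
    D*M₂ k≥1 = begin
      + D ℤ.* M₂
        ≡⟨ cong₂ ℤ._*_ +D≡ (∑-triangulations ℤ-commutativeSemiring n≥4 (λ s → + s ℤ.* + s)) ⟩
      (+ 2 ℤ.* + k ℤ.+ + 3) ℤ.* (+ 2 ℤ.* + k ℤ.+ + 3) ℤ.* (+ 2 ℤ.* + k ℤ.+ + 1) ℤ.* sumℤ _ (treesOf (2 ℕ.+ k))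
        ≡⟨ second-moment k ⟩
      (+ 2 ℤ.* + n ℤ.* + (3 ℕ.+ k) ℤ.* + k ℤ.* (+ k ℤ.- + 1) ℤ.+ + n ℤ.* + k ℤ.* (+ n ℤ.* + k) ℤ.* (+ 2 ℤ.* + k ℤ.+ + 1)) ℤ.* + N
        ≡⟨ cong (ℤ._* + N) (cong₂ ℤ._+_ (sym +e≡) (cong₂ ℤ._*_ (cong₂ ℤ._*_ (sym (ℤ.pos-* n k)) (sym (ℤ.pos-* n k))) (sym +d≡))) ⟩
      (+ e ℤ.+ + a ℤ.* + a ℤ.* + d) ℤ.* + N ∎
      where
      open ≡-Reasoning
      +D≡ : + D ≡ (+ 2 ℤ.* + k ℤ.+ + 3) ℤ.* (+ 2 ℤ.* + k ℤ.+ + 3) ℤ.* (+ 2 ℤ.* + k ℤ.+ + 1)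
      +D≡ = trans (ℤ.pos-* (b ^ 2) d) (cong₂ ℤ._*_
        (trans (cong (λ x → + (b * x)) (ℕ.*-identityʳ b)) (trans (ℤ.pos-* b b) (cong₂ ℤ._*_ +b≡ +b≡))) +d≡)
      +e≡ : + e ≡ + 2 ℤ.* + n ℤ.* + (3 ℕ.+ k) ℤ.* + k ℤ.* (+ k ℤ.- + 1)
      +e≡ = trans (ℤ.pos-* (2 * n * (3 ℕ.+ k) * k) (k ∸ 1)) (cong₂ ℤ._*_
        (trans (ℤ.pos-* (2 * n * (3 ℕ.+ k)) k) (cong (ℤ._* + k)
          (trans (ℤ.pos-* (2 * n) (3 ℕ.+ k)) (cong (ℤ._* + (3 ℕ.+ k)) (ℤ.pos-* 2 n)))))
        -- By k ≥ 1 the truncated difference is the integer k - 1.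
        (sym (trans (ℤ.m-n≡m⊖n k 1) (ℤ.⊖-≥ k≥1))))

    -- Substituting N μ for the first power sum leaves D (M₂ - N μ²) / N. As b μ = a, the product D
    -- μ² is a² d, exactly the part of D M₂ / N that is not `e`.
    D*variance : k ≥ 1 → fromℤ (+ D) ℚ.* variance n ≡ fromℤ (+ e)
    D*variance k≥1 = begin
      fromℤ (+ D) ℚ.* variance n
        ≡⟨ cong₂ (λ x y → fromℤ (+ D) ℚ.* ((+ 1 /₀ x) ℚ.* y)) (length-triangulations n≥4)
             (sumℚ-square (S n) μ (triangulations n)) ⟩
      fromℤ (+ D) ℚ.* (N⁻¹ ℚ.* (fromℤ M₂ ℚ.- (μ ℚ.+ μ) ℚ.* fromℤ M₁ ℚ.+ μ ℚ.* μ ℚ.* fromℤ (+ length (triangulations n))))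
        ≡⟨ cong₂ (λ x y → fromℤ (+ D) ℚ.* (N⁻¹ ℚ.* (fromℤ M₂ ℚ.- (μ ℚ.+ μ) ℚ.* x ℚ.+ μ ℚ.* μ ℚ.* fromℤ (+ y)))) M₁≡ (length-triangulations n≥4) ⟩
      fromℤ (+ D) ℚ.* (N⁻¹ ℚ.* (fromℤ M₂ ℚ.- (μ ℚ.+ μ) ℚ.* (fromℤ (+ N) ℚ.* μ) ℚ.+ μ ℚ.* μ ℚ.* fromℤ (+ N)))
        ≡⟨ l₁ (fromℤ (+ D)) N⁻¹ (fromℤ M₂) μ (fromℤ (+ N)) ⟩
      N⁻¹ ℚ.* (fromℤ (+ D) ℚ.* fromℤ M₂ ℚ.- fromℤ (+ D) ℚ.* μ ℚ.* μ ℚ.* fromℤ (+ N))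
        ≡⟨ cong₂ (λ x y → N⁻¹ ℚ.* (x ℚ.- y ℚ.* fromℤ (+ N))) DM₂ Dμ² ⟩
      N⁻¹ ℚ.* ((fromℤ (+ e) ℚ.+ E) ℚ.* fromℤ (+ N) ℚ.- E ℚ.* fromℤ (+ N))
        ≡⟨ l₂ N⁻¹ (fromℤ (+ e)) E (fromℤ (+ N)) ⟩
      fromℤ (+ e) ℚ.* (fromℤ (+ N) ℚ.* N⁻¹)
        ≡⟨ trans (cong (fromℤ (+ e) ℚ.*_) N*N⁻¹) (ℚ.*-identityʳ _) ⟩
      fromℤ (+ e) ∎
      where
      open ≡-Reasoning
      μ = mean n
      E = fromℤ (+ a ℤ.* + a ℤ.* + d)
      M₁≡ : fromℤ M₁ ≡ fromℤ (+ N) ℚ.* μ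
      M₁≡ = sym (trans (cong (fromℤ (+ N) ℚ.*_) mean≡M₁/N) (trans (sym (ℚ.*-assoc (fromℤ (+ N)) N⁻¹ (fromℤ M₁)))
        (trans (cong (ℚ._* fromℤ M₁) N*N⁻¹) (ℚ.*-identityˡ (fromℤ M₁)))))
      DM₂ : fromℤ (+ D) ℚ.* fromℤ M₂ ≡ (fromℤ (+ e) ℚ.+ E) ℚ.* fromℤ (+ N)
      DM₂ = trans (sym (fromℤ-homo-* (+ D) M₂)) (trans (cong fromℤ (D*M₂ k≥1))
        (trans (fromℤ-homo-* (+ e ℤ.+ + a ℤ.* + a ℤ.* + d) (+ N)) (cong (ℚ._* fromℤ (+ N)) (fromℤ-homo-+ (+ e) (+ a ℤ.* + a ℤ.* + d)))))
      +D≡ : fromℤ (+ D) ≡ fromℤ (+ b) ℚ.* fromℤ (+ b) ℚ.* fromℤ (+ d)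
      +D≡ = trans (cong fromℤ (trans (ℤ.pos-* (b ^ 2) d) (cong (ℤ._* + d) (trans (cong (λ x → + (b * x)) (ℕ.*-identityʳ b)) (ℤ.pos-* b b)))))
        (trans (fromℤ-homo-* (+ b ℤ.* + b) (+ d)) (cong (ℚ._* fromℤ (+ d)) (fromℤ-homo-* (+ b) (+ b))))
      Dμ² : fromℤ (+ D) ℚ.* μ ℚ.* μ ≡ E
      Dμ² = begin
        fromℤ (+ D) ℚ.* μ ℚ.* μ
          ≡⟨ cong (λ x → x ℚ.* μ ℚ.* μ) +D≡ ⟩
        fromℤ (+ b) ℚ.* fromℤ (+ b) ℚ.* fromℤ (+ d) ℚ.* μ ℚ.* μ
          ≡⟨ l₃ (fromℤ (+ b)) (fromℤ (+ d)) μ ⟩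
        (fromℤ (+ b) ℚ.* μ) ℚ.* (fromℤ (+ b) ℚ.* μ) ℚ.* fromℤ (+ d)
          ≡⟨ cong (λ x → x ℚ.* x ℚ.* fromℤ (+ d)) b*mean ⟩
        fromℤ (+ a) ℚ.* fromℤ (+ a) ℚ.* fromℤ (+ d)
          ≡⟨ cong (ℚ._* fromℤ (+ d)) (fromℤ-homo-* (+ a) (+ a)) ⟨
        fromℤ (+ a ℤ.* + a) ℚ.* fromℤ (+ d)
          ≡⟨ fromℤ-homo-* (+ a ℤ.* + a) (+ d) ⟨
        E ∎
        where
        l₃ : ∀ b d μ → b ℚ.* b ℚ.* d ℚ.* μ ℚ.* μ ≡ (b ℚ.* μ) ℚ.* (b ℚ.* μ) ℚ.* d
        l₃ = solve 3 (λ b d μ → b :* b :* d :* μ :* μ := (b :* μ) :* (b :* μ) :* d) refl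
          where open +-*-Solver
      l₁ : ∀ D i M μ N → D ℚ.* (i ℚ.* (M ℚ.- (μ ℚ.+ μ) ℚ.* (N ℚ.* μ) ℚ.+ μ ℚ.* μ ℚ.* N)) ≡ i ℚ.* (D ℚ.* M ℚ.- D ℚ.* μ ℚ.* μ ℚ.* N)
      l₁ = solve 5 (λ D i M μ N → D :* (i :* (M :- (μ :+ μ) :* (N :* μ) :+ μ :* μ :* N)) := i :* (D :* M :- D :* μ :* μ :* N)) refl
        where open +-*-Solver
      l₂ : ∀ i e E N → i ℚ.* ((e ℚ.+ E) ℚ.* N ℚ.- E ℚ.* N) ≡ e ℚ.* (N ℚ.* i)
      l₂ = solve 4 (λ i e E N → i :* ((e :+ E) :* N :- E :* N) := e :* (N :* i)) refl
        where open +-*-Solver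

    variance≡ : k ≥ 1 → variance n ≡ (+ e) /₀ D
    variance≡ k≥1 = /₀-unique (variance n) (+ e) D D≢0 (D*variance k≥1)

open import Data.Integer.Base using (+_)
open import Data.Nat.Base using (ℕ; _*_; _∸_; _^_; _≥_; z≤n; s≤s)
open import Data.Product.Base using (_×_; _,_)
open import Level using (Level)
open import Relation.Binary.PropositionalEquality.Core using (_≡_)

lemma2 : (c ℓ : Level) →
    ((A : ℚ-Algebra c ℓ) (n : ℕ) → n ≥ 4 → (z : ℚ-Algebra.Carrier A) →
    ℚ-Algebra._≈_ A (g A n z) (gFormula A n z))
    × ((n : ℕ) → n ≥ 4 →
    mean n ≡ (+ (n * (n ∸ 4))) /₀ (2 * n ∸ 5))
    × ((n : ℕ) → n ≥ 5 →
    variance n ≡ (+ (2 * n * (n ∸ 1) * (n ∸ 4) * (n ∸ 5)))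
    /₀ ((2 * n ∸ 5) ^ 2 * (2 * n ∸ 7)))
lemma2 c ℓ = Expectations.g≈gFormula
  -- Matching on the inequality replaces n by 4 + k; for n ≥ 5 what remains of it is 1 ≤ k.
  , (λ { _ (s≤s (s≤s (s≤s (s≤s {n = k} z≤n)))) → Expectations.mean≡ k })
  , (λ { _ (s≤s (s≤s (s≤s (s≤s {n = k} 1≤k)))) → Expectations.variance≡ k 1≤k })
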